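{- There is a deterministic algorithm which, given $A\in\mathbb R^{n\times d}$ and query access to $b\in\mathbb R^n$, reads $O(d\log\log d)$ entries of $b$ and outputs $\tilde x\in\mathbb R^d$ such that $$\|A\tilde x-b\|_\infty\le O(\sqrt d)\,\min_{x\in\mathbb R^d}\|Ax-b\|_\infty .$$
   Context: Active regression: the design matrix $A$ is fully known to the algorithm, while each entry of $b$ read counts as one query. $O(\cdot)$ hides absolute constants; $\log\log d$ is read as at least $1$. -}

module Defs where

open import Algebra.Bundles using (CommutativeRing)
open import Algebra.Core using (Op₁; Op₂)
open import Algebra.Structures using (IsCommutativeRing)
import Algebra.Construct.NaturalChoice.Max as NaturalMax
import Algebra.Properties.Ring as RingProperties
open import Data.Fin.Base using (Fin)
open import Data.Nat.Base as ℕ using (ℕ; zero; suc)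
open import Data.Nat.Logarithm using (⌊log₂_⌋)
open import Data.Product.Base using (∃; _×_; _,_; proj₁)
open import Data.Sum.Base using (inj₁; inj₂)
open import Data.Vec.Base using (Vec; map; zipWith; foldr′; lookup)
open import Level using (0ℓ)
open import Relation.Binary.Bundles using (DecTotalOrder)
open import Relation.Binary.Core using (Rel)
open import Relation.Binary.Structures using (IsDecTotalOrder)
open import Relation.Binary.PropositionalEquality
  using (_≡_; _≢_; sym; trans; cong; subst; subst₂)
open import Relation.Unary using (Pred)

-- The classical axioms of the real numbers.  They determine ℝ up to unique
-- isomorphism, so a statement about an arbitrary model is a statement about ℝ.
-- Equality is propositional: a function of real numbers cannot depend on how
-- they are represented.
record CompleteOrderedField : Set₁ where
  infix  8 -_
  infixl 7 _*_
  infixl 6 _+_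
  infix  4 _≤_
  field
    ℝ                 : Set
    _≤_               : Rel ℝ 0ℓ
    _+_ _*_           : Op₂ ℝ
    -_                : Op₁ ℝ
    0# 1#             : ℝ
    isCommutativeRing : IsCommutativeRing _≡_ _+_ _*_ -_ 0# 1#
    isDecTotalOrder   : IsDecTotalOrder _≡_ _≤_
    0#≢1#             : 0# ≢ 1#
    inverse           : ∀ x → x ≢ 0# → ∃ λ y → x * y ≡ 1#
    +-monoˡ-≤         : ∀ z {x y} → x ≤ y → x + z ≤ y + z
    *-nonNegative     : ∀ {x y} → 0# ≤ x → 0# ≤ y → 0# ≤ x * y

  IsUpperBound : Pred ℝ 0ℓ → ℝ → Set
  IsUpperBound P u = ∀ {x} → P x → x ≤ u

  IsSupremum : Pred ℝ 0ℓ → ℝ → Set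
  IsSupremum P s = IsUpperBound P s × (∀ {u} → IsUpperBound P u → s ≤ u)

  field
    supremum : (P : Pred ℝ 0ℓ) → ∃ P → ∃ (IsUpperBound P) → ∃ (IsSupremum P)

  commutativeRing : CommutativeRing 0ℓ 0ℓ
  commutativeRing = record { isCommutativeRing = isCommutativeRing }

  decTotalOrder : DecTotalOrder 0ℓ 0ℓ 0ℓ
  decTotalOrder = record { isDecTotalOrder = isDecTotalOrder }

  open CommutativeRing commutativeRing public
    using (_-_; +-identityˡ; +-identityʳ; +-comm; +-assoc; -‿inverseˡ; -‿inverseʳ;
           *-identityʳ; distribˡ; zeroˡ)
  open DecTotalOrder decTotalOrder public
    using (total; totalOrder)
    renaming (refl to ≤-refl; trans to ≤-trans)
  open NaturalMax totalOrder public using (_⊔_)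

module Regression (R : CompleteOrderedField) where
  open CompleteOrderedField R public

  open RingProperties (CommutativeRing.ring commutativeRing)
    using (-‿distribʳ-*; -‿involutive)

  x≤y⇒0≤y-x : ∀ {x y} → x ≤ y → 0# ≤ y - x
  x≤y⇒0≤y-x {x} {y} x≤y = subst (_≤ y - x) (-‿inverseʳ x) (+-monoˡ-≤ (- x) x≤y)

  0≤y-x⇒x≤y : ∀ {x y} → 0# ≤ y - x → x ≤ y
  0≤y-x⇒x≤y {x} {y} p = subst₂ _≤_ (+-identityˡ x)
    (trans (+-assoc y (- x) x) (trans (cong (y +_) (-‿inverseˡ x)) (+-identityʳ y)))
    (+-monoˡ-≤ x {0#} {y - x} p)

  0≤1 : 0# ≤ 1#
  0≤1 with total 0# 1#
  ... | inj₁ p = p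
  ... | inj₂ 1≤0 = subst (0# ≤_) -1*-1≡1 (*-nonNegative 0≤-1 0≤-1)
    where
    0≤-1 : 0# ≤ - 1#
    0≤-1 = subst (0# ≤_) (+-identityˡ (- 1#)) (x≤y⇒0≤y-x 1≤0)
    -1*-1≡1 : - 1# * - 1# ≡ 1#
    -1*-1≡1 = trans (sym (-‿distribʳ-* (- 1#) 1#))
                (trans (cong -_ (*-identityʳ (- 1#))) (-‿involutive 1#))

  x≤x+1 : ∀ x → x ≤ x + 1#
  x≤x+1 x = subst₂ _≤_ (+-identityˡ x) (+-comm 1# x) (+-monoˡ-≤ x 0≤1)

  fromℕ : ℕ → ℝ
  fromℕ zero    = 0#
  fromℕ (suc k) = fromℕ k + 1#

  0≤fromℕ : ∀ k → 0# ≤ fromℕ k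
  0≤fromℕ zero    = ≤-refl
  0≤fromℕ (suc k) = ≤-trans (0≤fromℕ k) (x≤x+1 (fromℕ k))

  1≤y⇒y≤y*y : ∀ {y} → 1# ≤ y → y ≤ y * y
  1≤y⇒y≤y*y {y} 1≤y = 0≤y-x⇒x≤y (subst (0# ≤_) y*[y-1]≡y*y-y
    (*-nonNegative (≤-trans 0≤1 1≤y) (x≤y⇒0≤y-x 1≤y)))
    where
    y*[y-1]≡y*y-y : y * (y - 1#) ≡ y * y - y
    y*[y-1]≡y*y-y = trans (distribˡ y y (- 1#)) (cong (y * y +_)
      (trans (sym (-‿distribʳ-* y 1#)) (cong -_ (*-identityʳ y))))

  -- √ k is the supremum of the y with y² ≤ k.
  SquareAtMost : ℕ → Pred ℝ 0ℓ
  SquareAtMost k y = y * y ≤ fromℕ k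

  squareAtMost-inhabited : ∀ k → ∃ (SquareAtMost k)
  squareAtMost-inhabited k = 0# , subst (_≤ fromℕ k) (sym (zeroˡ 0#)) (0≤fromℕ k)

  squareAtMost-bounded : ∀ k → ∃ (IsUpperBound (SquareAtMost k))
  squareAtMost-bounded k = fromℕ (suc k) , bound
    where
    bound : IsUpperBound (SquareAtMost k) (fromℕ (suc k))
    bound {y} y²≤k with total y (fromℕ (suc k))
    ... | inj₁ y≤k+1 = y≤k+1
    ... | inj₂ k+1≤y = ≤-trans (1≤y⇒y≤y*y 1≤y) (≤-trans y²≤k (x≤x+1 (fromℕ k)))
      where
      1≤y : 1# ≤ y
      1≤y = ≤-trans (subst (_≤ fromℕ (suc k)) (+-identityˡ 1#) (+-monoˡ-≤ 1# (0≤fromℕ k))) k+1≤y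

  infix 9 √_
  √_ : ℕ → ℝ
  √ k = proj₁ (supremum (SquareAtMost k) (squareAtMost-inhabited k) (squareAtMost-bounded k))

  ∣_∣ : ℝ → ℝ
  ∣ x ∣ = x ⊔ - x

  Vector : ℕ → Set
  Vector = Vec ℝ

  -- A matrix is the vector of its rows.
  Matrix : ℕ → ℕ → Set
  Matrix n d = Vec (Vector d) n

  dot : ∀ {d} → Vector d → Vector d → ℝ
  dot u v = foldr′ _+_ 0# (zipWith _*_ u v)

  infixr 7 _·_
  _·_ : ∀ {n d} → Matrix n d → Vector d → Vector n
  A · x = map (λ row → dot row x) A

  infixl 6 _⊖_
  _⊖_ : ∀ {n} → Vector n → Vector n → Vector n
  _⊖_ = zipWith _-_

  -- Starting the maximum at 0 is harmless, since absolute values are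
  -- nonnegative; it makes the norm of the empty vector 0.
  ‖_‖∞ : ∀ {n} → Vector n → ℝ
  ‖ v ‖∞ = foldr′ _⊔_ 0# (map ∣_∣ v)

  IsMinimum : {X : Set} → (X → ℝ) → ℝ → Set
  IsMinimum f m = (∃ λ x → f x ≡ m) × (∀ x → m ≤ f x)

  -- A deterministic adaptive query algorithm for a hidden vector of length n.
  -- Which entry is read next, when to stop and what to output may depend only
  -- on the values already read.
  data QueryAlgorithm (n : ℕ) (Out : Set) : Set where
    output : Out → QueryAlgorithm n Out
    read   : Fin n → (ℝ → QueryAlgorithm n Out) → QueryAlgorithm n Out

  run : ∀ {n Out} → QueryAlgorithm n Out → Vector n → Out
  run (output o) b = o
  run (read i k) b = run (k (lookup b i)) b

  -- The number of reads on input b; repeated reads of one entry all count.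
  queries : ∀ {n Out} → QueryAlgorithm n Out → Vector n → ℕ
  queries (output o) b = 0
  queries (read i k) b = suc (queries (k (lookup b i)) b)

-- log log d, read as at least 1.  Rounding down and taking base 2 change
-- max(1, log log d) by at most a constant factor.
loglog : ℕ → ℕ
loglog d = 1 ℕ.⊔ ⌊log₂ ⌊log₂ d ⌋ ⌋

{-# OPTIONS --safe #-}
module Submission where

-- Among all choices of 2d rows let S maximise det (ε I + ∑ a aᵀ), the sum being over the rows
-- in S.  Adding a row v multiplies the determinant by 1 + q, where q is the inverse form at v;
-- removing a row a from the enlarged sum M multiplies it by 1 - (the inverse form of M at a),
-- and these values sum to at most d over the 2d + 1 rows.  Maximality of S therefore gives
-- (1 + q) (d + 1) ≤ 2d + 1, so q ≤ 1, that is ⟨v , x⟩² ≤ ε ‖x‖² + ∑ ⟨a , x⟩² for all x.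
-- There are finitely many S, so one of them works for arbitrarily small ε, hence for ε = 0,
-- and then ‖A x‖∞ ≤ √(2d) ‖A_S x‖∞.  Reading b on S and minimising the ℓ∞ residual there
-- gives the algorithm.  Minimisers exist by Fourier–Motzkin elimination.

open import Defs
open import Algebra.Bundles using (CommutativeRing)
import Algebra.Construct.NaturalChoice.Max as NaturalMax
import Algebra.Properties.Ring as RingProperties
import Algebra.Properties.Semiring.Mult.TCOptimised as Mult
import Algebra.Solver.Ring as RingSolver
open import Algebra.Solver.Ring.AlmostCommutativeRing
  using (fromCommutativeRing; _-Raw-AlmostCommutative⟶_)
open import Data.Empty using (⊥)
open import Data.Fin.Base using (Fin; zero; suc)
open import Data.Integer.Base as ℤ using (ℤ; -[1+_])
import Data.Integer.Properties as ℤ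
open import Data.List.Base as List using (List; []; _∷_; filter; allFin; cartesianProductWith)
import Data.List.Extrema as Extrema
open import Data.List.Membership.Propositional using (_∈_)
open import Data.List.Membership.Propositional.Properties
open import Data.List.Relation.Unary.All as All using (All; []; _∷_)
import Data.List.Relation.Unary.All.Properties as All
open import Data.List.Relation.Unary.Any as Any using (Any; here)
open import Data.Maybe.Base using (Maybe; just; nothing)
open import Data.Nat.Base as ℕ using (ℕ; zero; suc; NonZero)
open import Data.Nat.Logarithm using (⌊log₂_⌋)
import Data.Nat.Properties as ℕ
open import Data.Product.Base using (∃; Σ; _×_; _,_; proj₁; proj₂)
open import Data.Sum.Base using (_⊎_; inj₁; inj₂)
open import Data.Vec.Base
  using (Vec; []; _∷_; _++_; map; zipWith; lookup; replicate; head; tail; removeAt)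
open import Data.Vec.Properties using (lookup-map; lookup-zipWith)
open import Function.Base using (_∘_)
open import Relation.Binary.Bundles using (DecTotalOrder)
open import Relation.Binary.PropositionalEquality
open import Relation.Nullary.Decidable using (Dec; yes; no; decidable-stable; ¬?)
open import Relation.Nullary.Negation using (¬_; contradiction)

-- The rows of A need not span, so without ε I every determinant may vanish and there is no inverse
-- form. The size 2d comes from the same exchange with k rows, which gives (1 + q) (k + 1 - d) ≤ k +
-- 1, that is q ≤ d / (k + 1 - d): taking k of order d keeps this bound constant, and k = 2d brings
-- it below 1. Forms are kept as LDLᵀ decompositions, so that the determinant and the inverse form
-- are recursions over the pivots and every estimate is an induction on the dimension through Schur
-- complements. The price is that one quadratic form, reached by adding rows in different orders,
-- has decompositions computed in different ways. Hypotheses on forms are therefore pointwise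
-- inequalities between their values, and a single such lemma covers both adding and removing a row.
-- No compactness is used: whether S works is decided by the completeness axiom, and the minimum is
-- attained because eliminating x leaves finitely many weak linear inequalities in the residual
-- bound t, which persist at the infimum.

module IntegerCoefficients (R : CompleteOrderedField) where
  open CompleteOrderedField R
  open CommutativeRing commutativeRing using (ring; semiring)
  open RingProperties ring using (-‿+-comm; -0#≈0#; -‿distribˡ-*; -‿distribʳ-*; -‿involutive)
  open Mult semiring using (×-homo-+; ×1-homo-*; 1+×) renaming (_×_ to _×ᴿ_)

  -- The ring solver needs coefficients with decidable equality. With these multiples the images of
  -- 0 and 1 reduce to `0#` and `1#`, so solver numerals match the constants in goals.
  embed : ℤ → ℝ
  embed (ℤ.+ n)    = n ×ᴿ 1#
  embed -[1+ n ] = - (suc n ×ᴿ 1#)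

  private
    cancel : ∀ x a b → (x + a) - (x + b) ≡ a - b
    cancel x a b = begin
      (x + a) - (x + b)         ≡⟨ cong₂ _+_ (+-comm x a) (sym (-‿+-comm x b)) ⟩
      (a + x) + (- x - b)       ≡⟨ +-assoc a x _ ⟩
      a + (x + (- x - b))       ≡⟨ cong (a +_) (sym (+-assoc x _ _)) ⟩
      a + ((x - x) - b)         ≡⟨ cong (λ z → a + (z - b)) (-‿inverseʳ x) ⟩
      a + (0# - b)              ≡⟨ cong (a +_) (+-identityˡ _) ⟩
      a - b                     ∎
      where open ≡-Reasoning

  embed-⊖ : ∀ m n → embed (m ℤ.⊖ n) ≡ m ×ᴿ 1# - n ×ᴿ 1#
  embed-⊖ zero    zero    = sym (-‿inverseʳ 0#)
  embed-⊖ zero    (suc n) = sym (+-identityˡ _)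
  embed-⊖ (suc m) zero    = sym (trans (cong (suc m ×ᴿ 1# +_) -0#≈0#) (+-identityʳ _))
  embed-⊖ (suc m) (suc n) = begin
    embed (suc m ℤ.⊖ suc n)          ≡⟨ cong embed (ℤ.[1+m]⊖[1+n]≡m⊖n m n) ⟩
    embed (m ℤ.⊖ n)                  ≡⟨ embed-⊖ m n ⟩
    m ×ᴿ 1# - n ×ᴿ 1#              ≡⟨ sym (cancel 1# _ _) ⟩
    (1# + m ×ᴿ 1#) - (1# + n ×ᴿ 1#) ≡⟨ sym (cong₂ _-_ (1+× m 1#) (1+× n 1#)) ⟩
    suc m ×ᴿ 1# - suc n ×ᴿ 1#      ∎
    where open ≡-Reasoning

  embed-+ : ∀ i j → embed (i ℤ.+ j) ≡ embed i + embed j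
  embed-+ (ℤ.+ m)    (ℤ.+ n)    = ×-homo-+ 1# m n
  embed-+ (ℤ.+ m)    -[1+ n ] = embed-⊖ m (suc n)
  embed-+ -[1+ m ] (ℤ.+ n)    = trans (embed-⊖ n (suc m)) (+-comm _ _)
  embed-+ -[1+ m ] -[1+ n ] = begin
    - (suc (suc (m ℕ.+ n)) ×ᴿ 1#)          ≡⟨ cong (λ k → - (suc k ×ᴿ 1#)) (sym (ℕ.+-suc m n)) ⟩
    - ((suc m ℕ.+ suc n) ×ᴿ 1#)            ≡⟨ cong -_ (×-homo-+ 1# (suc m) (suc n)) ⟩
    - (suc m ×ᴿ 1# + suc n ×ᴿ 1#)          ≡⟨ sym (-‿+-comm _ _) ⟩
    - (suc m ×ᴿ 1#) - suc n ×ᴿ 1#          ∎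
    where open ≡-Reasoning

  embed-neg : ∀ i → embed (ℤ.- i) ≡ - embed i
  embed-neg (ℤ.+ zero)  = sym -0#≈0#
  embed-neg (ℤ.+ suc n) = refl
  embed-neg -[1+ n ]  = sym (-‿involutive _)

  private
    embed-+* : ∀ m n → embed (ℤ.+ m ℤ.* ℤ.+ n) ≡ embed (ℤ.+ m) * embed (ℤ.+ n)
    embed-+* m n = trans (cong embed (sym (ℤ.pos-* m n))) (×1-homo-* m n)

  embed-* : ∀ i j → embed (i ℤ.* j) ≡ embed i * embed j
  embed-* (ℤ.+ m)    (ℤ.+ n)    = embed-+* m n
  embed-* (ℤ.+ m)    -[1+ n ] = begin
    embed (ℤ.+ m ℤ.* -[1+ n ])               ≡⟨ cong embed (sym (ℤ.neg-distribʳ-* (ℤ.+ m) (ℤ.+ suc n))) ⟩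
    embed (ℤ.- (ℤ.+ m ℤ.* ℤ.+ suc n))          ≡⟨ embed-neg (ℤ.+ m ℤ.* ℤ.+ suc n) ⟩
    - embed (ℤ.+ m ℤ.* ℤ.+ suc n)              ≡⟨ cong -_ (embed-+* m (suc n)) ⟩
    - (embed (ℤ.+ m) * embed (ℤ.+ suc n))      ≡⟨ -‿distribʳ-* _ _ ⟩
    embed (ℤ.+ m) * embed -[1+ n ]           ∎
    where open ≡-Reasoning
  embed-* -[1+ m ] (ℤ.+ n)    = begin
    embed (-[1+ m ] ℤ.* ℤ.+ n)               ≡⟨ cong embed (sym (ℤ.neg-distribˡ-* (ℤ.+ suc m) (ℤ.+ n))) ⟩
    embed (ℤ.- (ℤ.+ suc m ℤ.* ℤ.+ n))          ≡⟨ embed-neg (ℤ.+ suc m ℤ.* ℤ.+ n) ⟩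
    - embed (ℤ.+ suc m ℤ.* ℤ.+ n)              ≡⟨ cong -_ (embed-+* (suc m) n) ⟩
    - (embed (ℤ.+ suc m) * embed (ℤ.+ n))      ≡⟨ -‿distribˡ-* _ _ ⟩
    embed -[1+ m ] * embed (ℤ.+ n)           ∎
    where open ≡-Reasoning
  embed-* -[1+ m ] -[1+ n ] = begin
    embed (ℤ.+ suc m ℤ.* ℤ.+ suc n)            ≡⟨ embed-+* (suc m) (suc n) ⟩
    embed (ℤ.+ suc m) * embed (ℤ.+ suc n)      ≡⟨ sym (-‿involutive _) ⟩
    - - (embed (ℤ.+ suc m) * embed (ℤ.+ suc n)) ≡⟨ cong -_ (-‿distribʳ-* _ _) ⟩
    - (embed (ℤ.+ suc m) * embed -[1+ n ])   ≡⟨ -‿distribˡ-* _ _ ⟩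
    embed -[1+ m ] * embed -[1+ n ]        ∎
    where open ≡-Reasoning

  embedding : ℤ.+-*-rawRing -Raw-AlmostCommutative⟶ fromCommutativeRing commutativeRing
  embedding = record
    { ⟦_⟧    = embed
    ; +-homo = embed-+
    ; *-homo = embed-*
    ; -‿homo = embed-neg
    ; 0-homo = refl
    ; 1-homo = refl
    }

  embed-weaklyDecidable : ∀ i j → Maybe (embed i ≡ embed j)
  embed-weaklyDecidable i j with i ℤ.≟ j
  ... | yes i≡j = just (cong embed i≡j)
  ... | no  _   = nothing

  open RingSolver ℤ.+-*-rawRing (fromCommutativeRing commutativeRing) embedding embed-weaklyDecidable
    public using (solve; _:=_; con; _:+_; _:*_; _:-_; :-_)

module RegressionCoreset (R : CompleteOrderedField) where
  open Regression R
  open IntegerCoefficients R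
  open DecTotalOrder decTotalOrder using (_≟_; _≤?_; antisym; reflexive)
  open Extrema totalOrder using (argmax; f[xs]≤f[argmax])
  open NaturalMax totalOrder using (⊔-lub; x≤x⊔y; x≤y⊔x)

  private variable
    d k m n : ℕ
    X       : Set

  -- Ordered field inequalities

  infix 9 _²
  _² : ℝ → ℝ
  x ² = x * x

  +-nonNegative : ∀ {x y} → 0# ≤ x → 0# ≤ y → 0# ≤ x + y
  +-nonNegative {x} {y} 0≤x 0≤y =
    ≤-trans 0≤y (subst (_≤ x + y) (+-identityˡ y) (+-monoˡ-≤ y 0≤x))

  -- Inequalities are proved by exhibiting y - x as a sum of products of nonnegative terms;
  -- modulo supplies the multiple of a relation e ≡ 1 that such an identity may need.
  ≤-by : ∀ {x y p} → 0# ≤ p → y - x ≡ p → x ≤ y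
  ≤-by 0≤p y-x≡p = 0≤y-x⇒x≤y (subst (0# ≤_) (sym y-x≡p) 0≤p)

  modulo : ∀ {e x p} c → e ≡ 1# → x ≡ p + (e - 1#) * c → x ≡ p
  modulo {p = p} c refl x≡ = trans x≡ (solve 2 (λ p c → p :+ (con (ℤ.+ 1) :- con (ℤ.+ 1)) :* c := p) refl p c)

  neg-nonNegative : ∀ {x} → x ≤ 0# → 0# ≤ - x
  neg-nonNegative {x} x≤0 = subst (0# ≤_) (+-identityˡ (- x)) (x≤y⇒0≤y-x x≤0)

  ²-nonNegative : ∀ x → 0# ≤ x ²
  ²-nonNegative x with total 0# x
  ... | inj₁ 0≤x = *-nonNegative 0≤x 0≤x
  ... | inj₂ x≤0 = subst (0# ≤_) (solve 1 (λ x → :- x :* :- x := x :* x) refl x)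
                     (*-nonNegative (neg-nonNegative x≤0) (neg-nonNegative x≤0))

  1≰0 : ¬ 1# ≤ 0#
  1≰0 1≤0 = 0#≢1# (antisym 0≤1 1≤0)

  -- Strict positivity carries its reciprocal, so that division becomes multiplication by `x⁻¹` and
  -- `x*x⁻¹≡1` is the relation to pass to `modulo`.
  record Positive (x : ℝ) : Set where
    field
      x⁻¹                : ℝ
      x*x⁻¹≡1            : x * x⁻¹ ≡ 1#
      nonNegative        : 0# ≤ x
      inverseNonNegative : 0# ≤ x⁻¹

  open Positive

  positive⇒≰0 : ∀ {x} → Positive x → ¬ x ≤ 0#
  positive⇒≰0 {x} x>0 x≤0 = 1≰0 (≤-by (*-nonNegative (neg-nonNegative x≤0) (inverseNonNegative x>0))
    (modulo 1# (x*x⁻¹≡1 x>0)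
      (solve 2 (λ x y → con (ℤ.+ 0) :- con (ℤ.+ 1)
                       := :- x :* y :+ (x :* y :- con (ℤ.+ 1)) :* con (ℤ.+ 1)) refl x (x⁻¹ x>0))))

  sign : ∀ x → x ≤ 0# ⊎ Positive x
  sign x with total x 0#
  ... | inj₁ x≤0 = inj₁ x≤0
  ... | inj₂ 0≤x with x ≟ 0#
  ...   | yes x≡0 = inj₁ (reflexive x≡0)
  ...   | no  x≢0 with inverse x x≢0
  ...     | y , xy≡1 with total 0# y
  ...       | inj₁ 0≤y = inj₂ record
    { x⁻¹ = y ; x*x⁻¹≡1 = xy≡1 ; nonNegative = 0≤x ; inverseNonNegative = 0≤y }
  ...       | inj₂ y≤0 = contradiction
    (≤-by (*-nonNegative 0≤x (neg-nonNegative y≤0))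
      (modulo 1# xy≡1
      (solve 2 (λ x y → con (ℤ.+ 0) :- con (ℤ.+ 1)
                       := x :* (:- y) :+ (x :* y :- con (ℤ.+ 1)) :* con (ℤ.+ 1)) refl x y)))
    1≰0

  ≰0⇒positive : ∀ {x} → ¬ x ≤ 0# → Positive x
  ≰0⇒positive {x} x≰0 with sign x
  ... | inj₁ x≤0 = contradiction x≤0 x≰0
  ... | inj₂ x>0 = x>0

  positive-mono : ∀ {x y} → Positive x → x ≤ y → Positive y
  positive-mono x>0 x≤y = ≰0⇒positive (λ y≤0 → positive⇒≰0 x>0 (≤-trans x≤y y≤0))

  positive-1 : Positive 1#
  positive-1 = ≰0⇒positive 1≰0

  positive-* : ∀ {x y} → Positive x → Positive y → Positive (x * y)
  positive-* {x} {y} x>0 y>0 = record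
    { x⁻¹                = x⁻¹ x>0 * x⁻¹ y>0
    ; x*x⁻¹≡1            = modulo (y * x⁻¹ y>0) (x*x⁻¹≡1 x>0) (modulo 1# (x*x⁻¹≡1 y>0)
        (solve 4 (λ x x′ y y′ → x :* y :* (x′ :* y′)
          := con (ℤ.+ 1) :+ (x :* x′ :- con (ℤ.+ 1)) :* (y :* y′) :+ (y :* y′ :- con (ℤ.+ 1)) :* con (ℤ.+ 1))
          refl x (x⁻¹ x>0) y (x⁻¹ y>0)))
    ; nonNegative        = *-nonNegative (nonNegative x>0) (nonNegative y>0)
    ; inverseNonNegative = *-nonNegative (inverseNonNegative x>0) (inverseNonNegative y>0)
    }

  *-cancelˡ-≤ : ∀ {c x y} → Positive c → c * x ≤ c * y → x ≤ y
  *-cancelˡ-≤ {c} {x} {y} c>0 cx≤cy = ≤-by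
    (*-nonNegative (inverseNonNegative c>0) (x≤y⇒0≤y-x cx≤cy))
    (modulo (x - y) (x*x⁻¹≡1 c>0)
      (solve 4 (λ c c′ x y → y :- x := c′ :* (c :* y :- c :* x) :+ (c :* c′ :- con (ℤ.+ 1)) :* (x :- y))
        refl c (x⁻¹ c>0) x y))

  -- Finite sums and vector arithmetic

  ∑ : (X → ℝ) → Vec X k → ℝ
  ∑ f []       = 0#
  ∑ f (x ∷ xs) = f x + ∑ f xs

  ∑-map : ∀ {Y : Set} (f : Y → ℝ) (g : X → Y) (xs : Vec X k) → ∑ f (map g xs) ≡ ∑ (f ∘ g) xs
  ∑-map f g []       = refl
  ∑-map f g (x ∷ xs) = cong (f (g x) +_) (∑-map f g xs)

  ∑-cong : ∀ {f g : X → ℝ} → (∀ x → f x ≡ g x) → (xs : Vec X k) → ∑ f xs ≡ ∑ g xs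
  ∑-cong f≡g []       = refl
  ∑-cong f≡g (x ∷ xs) = cong₂ _+_ (f≡g x) (∑-cong f≡g xs)

  ∑-linear : ∀ (f g : X → ℝ) c (xs : Vec X k) → ∑ (λ x → f x * c + g x) xs ≡ ∑ f xs * c + ∑ g xs
  ∑-linear f g c []       = solve 1 (λ c → con (ℤ.+ 0) := con (ℤ.+ 0) :* c :+ con (ℤ.+ 0)) refl c
  ∑-linear f g c (x ∷ xs) = trans (cong (f x * c + g x +_) (∑-linear f g c xs))
    (solve 5 (λ a b c s t → a :* c :+ b :+ (s :* c :+ t) := (a :+ s) :* c :+ (b :+ t))
      refl (f x) (g x) c (∑ f xs) (∑ g xs))

  ∑-removeAt : ∀ (f : X → ℝ) (xs : Vec X (suc k)) i → ∑ f xs ≡ ∑ f (removeAt xs i) + f (lookup xs i)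
  ∑-removeAt f (x ∷ xs)         zero    = +-comm (f x) (∑ f xs)
  ∑-removeAt f (x ∷ xs@(_ ∷ _)) (suc i) = trans (cong (f x +_) (∑-removeAt f xs i)) (sym (+-assoc _ _ _))

  ∑-bound : ∀ (f : X → ℝ) c (xs : Vec X k) → (∀ i → f (lookup xs i) ≤ c) → ∑ f xs ≤ fromℕ k * c
  ∑-bound f c []       f≤c = reflexive (sym (zeroˡ c))
  ∑-bound {k = suc k} f c (x ∷ xs) f≤c = ≤-by
    (+-nonNegative (x≤y⇒0≤y-x (f≤c zero)) (x≤y⇒0≤y-x (∑-bound f c xs (f≤c ∘ suc))))
    (solve 4 (λ a b n c → (n :+ con (ℤ.+ 1)) :* c :- (a :+ b) := (c :- a) :+ (n :* c :- b))
      refl (f x) (∑ f xs) (fromℕ k) c)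

  infixl 6 _+[_]_
  _+[_]_ : Vector d → ℝ → Vector d → Vector d
  u +[ c ] w = zipWith (λ a b → a + c * b) u w

  dot-+[] : ∀ (u : Vector d) c w x → dot (u +[ c ] w) x ≡ dot u x + c * dot w x
  dot-+[] []      c []      []      = solve 1 (λ c → con (ℤ.+ 0) := con (ℤ.+ 0) :+ c :* con (ℤ.+ 0)) refl c
  dot-+[] (a ∷ u) c (b ∷ w) (ξ ∷ x) = trans (cong ((a + c * b) * ξ +_) (dot-+[] u c w x))
    (solve 6 (λ a b c ξ s t → (a :+ c :* b) :* ξ :+ (s :+ c :* t) := a :* ξ :+ s :+ c :* (b :* ξ :+ t))
      refl a b c ξ (dot u x) (dot w x))

  0ᵥ : Vector d
  0ᵥ = replicate _ 0#

  dot-0ᵥ : ∀ (u : Vector d) → dot u 0ᵥ ≡ 0#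
  dot-0ᵥ []      = refl
  dot-0ᵥ (a ∷ u) = trans (cong (a * 0# +_) (dot-0ᵥ u))
    (solve 1 (λ a → a :* con (ℤ.+ 0) :+ con (ℤ.+ 0) := con (ℤ.+ 0)) refl a)

  e₁ : Vector (suc d)
  e₁ = 1# ∷ 0ᵥ

  dot-e₁ : ∀ (v : Vector (suc d)) → dot v e₁ ≡ head v
  dot-e₁ (β ∷ w) = trans (cong (β * 1# +_) (dot-0ᵥ w))
    (solve 1 (λ β → β :* con (ℤ.+ 1) :+ con (ℤ.+ 0) := β) refl β)

  -- Positive definite quadratic forms

  -- A positive definite quadratic form, given by its LDLᵀ decomposition:
  -- pivot α u Q is α (ξ + ⟨u , y⟩)² + Q(y) at the point ξ ∷ y.
  data Form : ℕ → Set where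
    []    : Form 0
    pivot : (α : ℝ) → Positive α → Vector d → Form d → Form (suc d)

  form : Form d → Vector d → ℝ
  form []              []      = 0#
  form (pivot α _ u Q) (ξ ∷ y) = α * (ξ + dot u y) ² + form Q y

  -- The factor L is unitriangular, so only the pivots contribute.
  det : Form d → ℝ
  det []              = 1#
  det (pivot α _ u Q) = α * det Q

  -- The restriction of ⟨v , ·⟩ to the hyperplane ξ = - ⟨u , y⟩, on which the first square of a form
  -- with pivot vector u vanishes.
  reduce : Vector d → Vector (suc d) → Vector d
  reduce u v = tail v +[ - head v ] u

  -- The inverse form: dual Q v = sup ⟨v , x⟩² / Q(x).
  dual : Form d → Vector d → ℝ
  dual []                v = 0#
  dual (pivot α α>0 u Q) v = head v ² * x⁻¹ α>0 + dual Q (reduce u v)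

  det-positive : ∀ (Q : Form d) → Positive (det Q)
  det-positive []                = positive-1
  det-positive (pivot α α>0 u Q) = positive-* α>0 (det-positive Q)

  dual-nonNegative : ∀ (Q : Form d) v → 0# ≤ dual Q v
  dual-nonNegative []                v = ≤-refl
  dual-nonNegative (pivot α α>0 u Q) v = +-nonNegative
    (*-nonNegative (²-nonNegative (head v)) (inverseNonNegative α>0)) (dual-nonNegative Q (reduce u v))

  form-0ᵥ : ∀ (Q : Form d) → form Q 0ᵥ ≡ 0#
  form-0ᵥ []              = refl
  form-0ᵥ (pivot α _ u Q) = trans (cong₂ (λ s t → α * (0# + s) ² + t) (dot-0ᵥ u) (form-0ᵥ Q))
    (solve 1 (λ α → let z = con (ℤ.+ 0) in α :* ((z :+ z) :* (z :+ z)) :+ z := z) refl α)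

  form-e₁ : ∀ α (α>0 : Positive α) u (Q : Form d) → form (pivot α α>0 u Q) e₁ ≡ α
  form-e₁ α _ u Q = trans (cong₂ (λ s t → α * (1# + s) ² + t) (dot-0ᵥ u) (form-0ᵥ Q))
    (solve 1 (λ α → let z = con (ℤ.+ 0) ; o = con (ℤ.+ 1) in α :* ((o :+ z) :* (o :+ z)) :+ z := α) refl α)

  -- Let Z = ξ + ⟨u , y⟩ and T = ⟨w₀ , y⟩. Then ⟨v , x⟩ = β Z + T, and completing the square gives α
  -- Z² + s (β Z + T)² = α′ (Z + s β T / α′)² + (s α / α′) T². What remains is an update of the same
  -- kind, one dimension lower, with weight s α / α′.
  addSquare : (Q : Form d) (s : ℝ) → 0# ≤ s → (v : Vector d) →
              ∃ λ Q′ → ∀ x → form Q′ x ≡ form Q x + s * (dot v x) ²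
  addSquare []                s 0≤s []      = [] , λ { [] →
    solve 1 (λ s → let z = con (ℤ.+ 0) in z := z :+ s :* (z :* z)) refl s }
  addSquare {suc d} (pivot α α>0 u Q) s 0≤s (β ∷ w) = pivot α′ α′>0 (u +[ s * β * κ ] w₀) Q′ , correct
    where
    α′ = α + s * β ²
    α′>0 = positive-mono α>0 (≤-by {p = s * β ²} (*-nonNegative 0≤s (²-nonNegative β))
             (solve 2 (λ a b → (a :+ b) :- a := b) refl α (s * β ²)))
    κ = x⁻¹ α′>0
    w₀ = reduce u (β ∷ w)
    rest = addSquare Q (s * α * κ)
      (*-nonNegative (*-nonNegative 0≤s (nonNegative α>0)) (inverseNonNegative α′>0)) w₀
    Q′ = proj₁ rest
    correct : ∀ x → form (pivot α′ α′>0 (u +[ s * β * κ ] w₀) Q′) x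
                    ≡ form (pivot α α>0 u Q) x + s * (dot (β ∷ w) x) ²
    correct (ξ ∷ y) = modulo _ (x*x⁻¹≡1 α′>0) (trans
      (cong₂ (λ a b → α′ * (ξ + a) ² + b)
        (trans (dot-+[] u (s * β * κ) w₀ y) (cong (λ t → dot u y + s * β * κ * t) (dot-+[] w (- β) u y)))
        (trans (proj₂ rest y) (cong (λ t → form Q y + s * α * κ * t ²) (dot-+[] w (- β) u y))))
      (solve 8 (λ α s β ξ U W κ q →
         let T = W :+ :- β :* U ; α′ = α :+ s :* (β :* β) ; X = ξ :+ (U :+ s :* β :* κ :* T) ; Z = ξ :+ U
             V = β :* ξ :+ W in
         α′ :* (X :* X) :+ (q :+ s :* α :* κ :* (T :* T))
         := α :* (Z :* Z) :+ q :+ s :* (V :* V) :+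
            (α′ :* κ :- con (ℤ.+ 1)) :* (s :* (T :* T) :+ s :* s :* (β :* β) :* κ :* (T :* T) :+ con (ℤ.+ 2) :* (s :* β :* Z :* T)))
        refl α s β ξ (dot u y) (dot w y) κ (form Q y)))

  -- The matrix determinant lemma, det (P + s v vᵀ) = det P (1 + s vᵀ P⁻¹ v), merged with
  -- monotonicity of the determinant. The weight s may be negative: s = 1 adds a row and s = -1
  -- removes one.
  det-addSquare : ∀ (P Q : Form d) s v → (∀ x → form P x + s * (dot v x) ² ≤ form Q x) →
                  det P * (1# + s * dual P v) ≤ det Q
  det-addSquare [] [] s [] _ = reflexive
    (solve 1 (λ s → con (ℤ.+ 1) :* (con (ℤ.+ 1) :+ s :* con (ℤ.+ 0)) := con (ℤ.+ 1)) refl s)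
  det-addSquare {suc d} P@(pivot α α>0 u P₀) Q@(pivot γ γ>0 t Q₀) s v@(β ∷ w) P+v²≤Q = compare (sign α′)
    where
    ι = x⁻¹ α>0
    w₀ = reduce u v
    α′ = α + s * β ²
    D = det P₀
    q = dual P₀ w₀

    sβ² : α′ - α ≡ s * β ²
    sβ² = solve 2 (λ a b → (a :+ b) :- a := b) refl α (s * β ²)

    α′≤γ : α′ ≤ γ
    α′≤γ = subst₂ _≤_
      (cong₂ (λ a b → a + s * b ²) (form-e₁ α α>0 u P₀) (dot-e₁ v)) (form-e₁ γ γ>0 t Q₀) (P+v²≤Q e₁)

    s≤0 : α′ ≤ 0# → s ≤ 0#
    s≤0 α′≤0 with total s 0#
    ... | inj₁ s≤0 = s≤0
    ... | inj₂ 0≤s = contradiction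
      (≤-trans (≤-by (*-nonNegative 0≤s (²-nonNegative β)) sβ²) α′≤0) (positive⇒≰0 α>0)

    compare : α′ ≤ 0# ⊎ Positive α′ → det P * (1# + s * dual P v) ≤ det Q
    -- Here s ≤ 0, so the left-hand side, which is D (α′ + s α q), is at most 0, while `det Q` is
    -- positive.
    compare (inj₁ α′≤0) = ≤-by
      (+-nonNegative (nonNegative (det-positive Q))
        (+-nonNegative
          (*-nonNegative (nonNegative (det-positive P₀)) (neg-nonNegative α′≤0))
          (*-nonNegative (*-nonNegative (nonNegative (det-positive P)) (dual-nonNegative P₀ w₀))
                         (neg-nonNegative (s≤0 α′≤0)))))
      (modulo (- (D * s * β ²)) (x*x⁻¹≡1 α>0)
        (solve 7 (λ α ι s β D q G →
          G :- α :* D :* (con (ℤ.+ 1) :+ s :* (β :* β :* ι :+ q))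
          := G :+ (D :* (:- (α :+ s :* (β :* β))) :+ α :* D :* q :* (:- s))
             :+ (α :* ι :- con (ℤ.+ 1)) :* (:- (D :* s :* (β :* β))))
          refl α ι s β D q (det Q)))
    -- Since α (1 + s (β² / α + q)) = α′ (1 + s′ q), the pivots are compared by `α′≤γ` and the Schur
    -- complements by induction.
    compare (inj₂ α′>0) = ≤-by
      (+-nonNegative
        (*-nonNegative (x≤y⇒0≤y-x α′≤γ) (nonNegative (det-positive Q₀)))
        (*-nonNegative (nonNegative α′>0) (x≤y⇒0≤y-x (det-addSquare P₀ Q₀ s′ w₀ schur))))
      (modulo (D * s * α * q) (x*x⁻¹≡1 α′>0) (modulo (- (D * s * β ²)) (x*x⁻¹≡1 α>0)
        (solve 9 (λ α ι s β D q γ κ E →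
          let α′ = α :+ s :* (β :* β) in
          γ :* E :- α :* D :* (con (ℤ.+ 1) :+ s :* (β :* β :* ι :+ q))
          := (γ :- α′) :* E :+ α′ :* (E :- D :* (con (ℤ.+ 1) :+ s :* α :* κ :* q))
             :+ (α′ :* κ :- con (ℤ.+ 1)) :* (D :* s :* α :* q)
             :+ (α :* ι :- con (ℤ.+ 1)) :* (:- (D :* s :* (β :* β))))
          refl α ι s β D q γ κ (det Q₀))))
      where
      κ = x⁻¹ α′>0
      s′ = s * α * κ

      -- The right-hand side form vanishes in its first square at (- ⟨t , y⟩) ∷ y.
      schur : ∀ y → form P₀ y + s′ * (dot w₀ y) ² ≤ form Q₀ y
      schur y = subst (λ p → form P₀ y + s′ * p ² ≤ form Q₀ y) (sym (dot-+[] w (- β) u y)) (≤-by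
        (+-nonNegative (x≤y⇒0≤y-x (P+v²≤Q (- dot t y ∷ y)))
          (*-nonNegative (inverseNonNegative α′>0)
            (²-nonNegative (α′ * (dot u y - dot t y) + s * β * (dot w y + - β * dot u y)))))
        (modulo _ (x*x⁻¹≡1 α′>0)
          (solve 10 (λ α s β κ γ U T W f g →
            let α′ = α :+ s :* (β :* β) ; p = W :+ (:- β) :* U ; z = U :- T
                P = (:- T :+ U) ; Q = :- T :+ T ; V = β :* (:- T) :+ W
                N = α′ :* z :+ s :* β :* p in
            g :- (f :+ s :* α :* κ :* (p :* p))
            := (γ :* (Q :* Q) :+ g :- (α :* (P :* P) :+ f :+ s :* (V :* V))) :+ κ :* (N :* N)
               :+ (α′ :* κ :- con (ℤ.+ 1)) :*
                  (:- (α′ :* (z :* z) :+ con (ℤ.+ 2) :* (s :* β :* p :* z) :+ s :* (p :* p))))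
            refl α s β κ γ (dot u y) (dot t y) (dot w y) (form P₀ y) (form Q₀ y))))

  -- If ∑ v vᵀ ≤ Q then the trace of Q⁻¹ ∑ v vᵀ is at most that of the identity. Each pivot accounts
  -- for at most 1: evaluating at `e₁` bounds the squared heads, and the hyperplane where the first
  -- square vanishes passes the hypothesis on to the reduced vectors.
  ∑-dual≤dimension : ∀ (Q : Form d) (vs : Vec (Vector d) k) →
                     (∀ x → ∑ (λ v → (dot v x) ²) vs ≤ form Q x) → ∑ (dual Q) vs ≤ fromℕ d
  ∑-dual≤dimension [] vs _ = reflexive (∑-zero vs)
    where
    ∑-zero : ∀ {k} (vs : Vec X k) → ∑ (λ _ → 0#) vs ≡ 0#
    ∑-zero []       = refl
    ∑-zero (v ∷ vs) = trans (+-identityˡ _) (∑-zero vs)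
  ∑-dual≤dimension {suc d} Q@(pivot α α>0 u Q₀) vs vs≤Q = ≤-by
    (+-nonNegative
      (*-nonNegative (inverseNonNegative α>0) (x≤y⇒0≤y-x heads≤α))
      (x≤y⇒0≤y-x (∑-dual≤dimension Q₀ (map (reduce u) vs) reduced≤Q₀)))
    (modulo (- 1#) (x*x⁻¹≡1 α>0) (trans (cong (λ t → fromℕ d + 1# - t) split)
      (solve 5 (λ n a b α ι → n :+ con (ℤ.+ 1) :- (a :* ι :+ b)
        := ι :* (α :- a) :+ (n :- b) :+ (α :* ι :- con (ℤ.+ 1)) :* (:- con (ℤ.+ 1)))
        refl (fromℕ d) (∑ (λ v → head v ²) vs) (∑ (dual Q₀) (map (reduce u) vs)) α (x⁻¹ α>0))))
    where
    split : ∑ (dual Q) vs ≡ ∑ (λ v → head v ²) vs * x⁻¹ α>0 + ∑ (dual Q₀) (map (reduce u) vs)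
    split = trans (∑-linear (λ v → head v ²) (dual Q₀ ∘ reduce u) (x⁻¹ α>0) vs)
                  (cong (∑ (λ v → head v ²) vs * x⁻¹ α>0 +_) (sym (∑-map (dual Q₀) (reduce u) vs)))

    heads≤α : ∑ (λ v → head v ²) vs ≤ α
    heads≤α = subst₂ _≤_ (∑-cong (λ v → cong _² (dot-e₁ v)) vs) (form-e₁ α α>0 u Q₀) (vs≤Q e₁)

    reduced≤Q₀ : ∀ y → ∑ (λ v → (dot v y) ²) (map (reduce u) vs) ≤ form Q₀ y
    reduced≤Q₀ y = subst₂ _≤_
      (trans (∑-cong point vs) (sym (∑-map (λ v → (dot v y) ²) (reduce u) vs)))
      (solve 3 (λ α U q → α :* ((:- U :+ U) :* (:- U :+ U)) :+ q := q) refl α (dot u y) (form Q₀ y))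
      (vs≤Q (- dot u y ∷ y))
      where
      point : ∀ v → (dot v (- dot u y ∷ y)) ² ≡ (dot (reduce u v) y) ²
      point (β ∷ w) = cong _² (trans
        (solve 3 (λ β U W → β :* (:- U) :+ W := W :+ (:- β) :* U) refl β (dot u y) (dot w y))
        (sym (dot-+[] w (- β) u y)))

  -- Each pivot leaves the slack (c β - α (ξ + ⟨u , y⟩))² / α. Putting c = ⟨v , x⟩ yields the
  -- Cauchy-Schwarz bound needed next without dividing by Q(x).
  young : ∀ (Q : Form d) c v x → c * dot v x + c * dot v x ≤ c ² * dual Q v + form Q x
  young []                c []      []      = reflexive
    (solve 1 (λ c → let z = con (ℤ.+ 0) in c :* z :+ c :* z := c :* c :* z :+ z) refl c)
  young (pivot α α>0 u Q) c (β ∷ w) (ξ ∷ y) = ≤-by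
    (+-nonNegative (x≤y⇒0≤y-x (young Q c w₀ y))
      (*-nonNegative (inverseNonNegative α>0) (²-nonNegative (c * β - α * (ξ + dot u y)))))
    (trans (modulo _ (x*x⁻¹≡1 α>0)
      (solve 9 (λ α ι c β ξ U W q f →
        let Z = ξ :+ U ; p = W :+ (:- β) :* U ; V = β :* ξ :+ W ; N = c :* β :- α :* Z in
        c :* c :* (β :* β :* ι :+ q) :+ (α :* (Z :* Z) :+ f) :- (c :* V :+ c :* V)
        := (c :* c :* q :+ f :- (c :* p :+ c :* p)) :+ ι :* (N :* N)
           :+ (α :* ι :- con (ℤ.+ 1)) :* (con (ℤ.+ 2) :* (c :* β :* Z) :- α :* (Z :* Z)))
        refl α (x⁻¹ α>0) c β ξ (dot u y) (dot w y) (dual Q w₀) (form Q y)))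
      (cong (λ p → c ² * dual Q w₀ + form Q y - (c * p + c * p)
                   + x⁻¹ α>0 * (c * β - α * (ξ + dot u y)) ²) (sym (dot-+[] w (- β) u y))))
    where w₀ = reduce u (β ∷ w)

  dual≤1⇒dot²≤form : ∀ (Q : Form d) v → dual Q v ≤ 1# → ∀ x → (dot v x) ² ≤ form Q x
  dual≤1⇒dot²≤form Q v q≤1 x = ≤-by
    (+-nonNegative (*-nonNegative (²-nonNegative c) (x≤y⇒0≤y-x q≤1)) (x≤y⇒0≤y-x (young Q c v x)))
    (solve 3 (λ c q f → f :- c :* c
        := c :* c :* (con (ℤ.+ 1) :- q) :+ (c :* c :* q :+ f :- (c :* c :+ c :* c))) refl c (dual Q v) (form Q x))
    where c = dot v x

  -- Regularised Gram forms and the exchange argument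

  ridge : ∀ {ε} d → Positive ε → Form d
  ridge {ε} zero    ε>0 = []
  ridge {ε} (suc d) ε>0 = pivot ε ε>0 0ᵥ (ridge d ε>0)

  ‖_‖² : Vector d → ℝ
  ‖ x ‖² = ∑ _² x

  ‖‖²-nonNegative : (x : Vector d) → 0# ≤ ‖ x ‖²
  ‖‖²-nonNegative []      = ≤-refl
  ‖‖²-nonNegative (ξ ∷ x) = +-nonNegative (²-nonNegative ξ) (‖‖²-nonNegative x)

  dot-0ᵥˡ : ∀ (x : Vector d) → dot 0ᵥ x ≡ 0#
  dot-0ᵥˡ []      = refl
  dot-0ᵥˡ (ξ ∷ x) = trans (cong (0# * ξ +_) (dot-0ᵥˡ x))
    (solve 1 (λ a → con (ℤ.+ 0) :* a :+ con (ℤ.+ 0) := con (ℤ.+ 0)) refl ξ)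

  form-ridge : ∀ {ε} (ε>0 : Positive ε) (x : Vector d) → form (ridge d ε>0) x ≡ ε * ‖ x ‖²
  form-ridge {ε = ε} ε>0 []      = solve 1 (λ ε → con (ℤ.+ 0) := ε :* con (ℤ.+ 0)) refl ε
  form-ridge {ε = ε} ε>0 (ξ ∷ x) = trans (cong₂ (λ a b → ε * (ξ + a) ² + b) (dot-0ᵥˡ x) (form-ridge ε>0 x))
    (solve 3 (λ ε ξ n → let z = ξ :+ con (ℤ.+ 0) in ε :* (z :* z) :+ ε :* n := ε :* (ξ :* ξ :+ n)) refl ε ξ ‖ x ‖²)

  fromℕ-+ : ∀ m n → fromℕ (m ℕ.+ n) ≡ fromℕ m + fromℕ n
  fromℕ-+ zero    n = sym (+-identityˡ _)
  fromℕ-+ (suc m) n = trans (cong (_+ 1#) (fromℕ-+ m n))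
    (solve 2 (λ a b → a :+ b :+ con (ℤ.+ 1) := a :+ con (ℤ.+ 1) :+ b) refl (fromℕ m) (fromℕ n))

  module _ {ε : ℝ} (ε>0 : Positive ε) where
    gram : Vec (Vector d) k → Form d
    gram []       = ridge _ ε>0
    gram (v ∷ vs) = proj₁ (addSquare (gram vs) 1# 0≤1 v)

    form-gram : ∀ (vs : Vec (Vector d) k) x → form (gram vs) x ≡ ε * ‖ x ‖² + ∑ (λ v → (dot v x) ²) vs
    form-gram []       x = trans (form-ridge ε>0 x) (sym (+-identityʳ _))
    form-gram (v ∷ vs) x = trans (proj₂ (addSquare (gram vs) 1# 0≤1 v) x)
      (trans (cong (_+ 1# * (dot v x) ²) (form-gram vs x))
        (solve 3 (λ a b c → a :+ b :+ con (ℤ.+ 1) :* c := a :+ (c :+ b)) refl (ε * ‖ x ‖²) _ _))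

    exchange : ∀ (v : Vector d) (vs : Vec (Vector d) (d ℕ.+ d)) →
               (∀ i → det (gram (removeAt (v ∷ vs) i)) ≤ det (gram vs)) → dual (gram vs) v ≤ 1#
    exchange {d} v vs optimal = *-cancelˡ-≤ c>0 (≤-by
      (+-nonNegative (*-nonNegative (0≤fromℕ (suc d)) (x≤y⇒0≤y-x grow))
        (+-nonNegative (+-nonNegative
          (*-nonNegative (nonNegative (det-positive G′)) (x≤y⇒0≤y-x trace)) (x≤y⇒0≤y-x shrink))
          (nonNegative (det-positive G))))
      -- Together `grow`, `trace` and `shrink` give (d + 1) (1 + q) ≤ 2d + 1; the final summand `g`
      -- is the slack between 2d + 1 and 2 (d + 1).
      (solve 5 (λ n g q g′ S → let n′ = n :+ con (ℤ.+ 1) in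
         n′ :* g :* con (ℤ.+ 1) :- n′ :* g :* q
         := n′ :* (g′ :- g :* (con (ℤ.+ 1) :+ con (ℤ.+ 1) :* q))
            :+ (g′ :* (n :- S) :+ ((n :+ n :+ con (ℤ.+ 1)) :* g :- g′ :* ((n :+ n :+ con (ℤ.+ 1)) :- S)) :+ g))
         refl (fromℕ d) (det G) q (det G′) S))
      where
      G = gram vs
      G′ = gram (v ∷ vs)
      q = dual G v
      S = ∑ (dual G′) (v ∷ vs)

      c>0 : Positive (fromℕ (suc d) * det G)
      c>0 = positive-* (positive-mono positive-1 (≤-by (0≤fromℕ d)
        (solve 1 (λ n → n :+ con (ℤ.+ 1) :- con (ℤ.+ 1) := n) refl (fromℕ d)))) (det-positive G)

      grow : det G * (1# + 1# * q) ≤ det G′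
      grow = det-addSquare G G′ 1# v λ x → reflexive (sym (proj₂ (addSquare G 1# 0≤1 v) x))

      trace : S ≤ fromℕ d
      trace = ∑-dual≤dimension G′ (v ∷ vs) λ x → ≤-by
        (*-nonNegative (nonNegative ε>0) (‖‖²-nonNegative x))
        (trans (cong (_- ∑ (λ v → (dot v x) ²) (v ∷ vs)) (form-gram (v ∷ vs) x))
          (solve 2 (λ a b → a :+ b :- b := a) refl (ε * ‖ x ‖²) (∑ (λ v → (dot v x) ²) (v ∷ vs))))

      -- Removal is an update of weight -1. The forms `G′` and `H` are built from different lists,
      -- so they are compared through their values.
      drop : ∀ i → det G′ * (1# - dual G′ (lookup (v ∷ vs) i)) ≤ det G
      drop i = ≤-trans (subst (_≤ det H) (cong (det G′ *_)
          (solve 1 (λ q → con (ℤ.+ 1) :+ (:- con (ℤ.+ 1)) :* q := con (ℤ.+ 1) :- q) refl _))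
          (det-addSquare G′ H (- 1#) a λ x → reflexive (H-form x))) (optimal i)
        where
        H = gram (removeAt (v ∷ vs) i)
        a = lookup (v ∷ vs) i
        H-form : ∀ x → form G′ x + - 1# * (dot a x) ² ≡ form H x
        H-form x = trans (cong (_+ - 1# * (dot a x) ²) (trans (form-gram (v ∷ vs) x)
            (cong (ε * ‖ x ‖² +_) (∑-removeAt (λ v → (dot v x) ²) (v ∷ vs) i))))
          (trans (solve 3 (λ a b c → a :+ (b :+ c) :+ (:- con (ℤ.+ 1)) :* c := a :+ b) refl
                   (ε * ‖ x ‖²) (∑ (λ v → (dot v x) ²) (removeAt (v ∷ vs) i)) ((dot a x) ²))
                 (sym (form-gram (removeAt (v ∷ vs) i) x)))

      shrink : det G′ * (fromℕ d + fromℕ d + 1# - S) ≤ (fromℕ d + fromℕ d + 1#) * det G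
      shrink = subst₂ _≤_
        (trans (∑-complement (v ∷ vs)) (cong (λ n → det G′ * (n + 1# - S)) (fromℕ-+ d d)))
        (cong (λ n → (n + 1#) * det G) (fromℕ-+ d d))
        (∑-bound (λ a → det G′ * (1# - dual G′ a)) (det G) (v ∷ vs) drop)
        where
        ∑-complement : ∀ {k} (xs : Vec (Vector d) k) →
          ∑ (λ a → det G′ * (1# - dual G′ a)) xs ≡ det G′ * (fromℕ k - ∑ (dual G′) xs)
        ∑-complement []       = solve 1 (λ g → con (ℤ.+ 0) := g :* (con (ℤ.+ 0) :- con (ℤ.+ 0))) refl (det G′)
        ∑-complement {suc k} (x ∷ xs) = trans (cong (det G′ * (1# - dual G′ x) +_) (∑-complement xs))
          (solve 4 (λ g a n s → g :* (con (ℤ.+ 1) :- a) :+ g :* (n :- s) := g :* (n :+ con (ℤ.+ 1) :- (a :+ s)))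
            refl (det G′) (dual G′ x) (fromℕ k) (∑ (dual G′) xs))

  -- Row selection

  positive-inverse : ∀ {x} (x>0 : Positive x) → Positive (x⁻¹ x>0)
  positive-inverse {x} x>0 = record
    { x⁻¹                = x
    ; x*x⁻¹≡1            = trans (solve 2 (λ a b → a :* b := b :* a) refl (x⁻¹ x>0) x) (x*x⁻¹≡1 x>0)
    ; nonNegative        = inverseNonNegative x>0
    ; inverseNonNegative = nonNegative x>0
    }

  ≤-vanishing : ∀ {a b n} → 0# ≤ n → (∀ {ε} → Positive ε → a ≤ ε * n + b) → a ≤ b
  ≤-vanishing {a} {b} {n} 0≤n a≤εn+b with sign (a - b)
  ... | inj₁ a-b≤0 = ≤-by (neg-nonNegative a-b≤0)
    (solve 2 (λ a b → b :- a := :- (a :- b)) refl a b)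
  -- For ε = (a - b) / (n + 1) the hypothesis says ε (n + 1) ≤ ε n, so ε ≤ 0. The added 1 covers n =
  -- 0.
  ... | inj₂ δ>0 = contradiction
    (≤-by (x≤y⇒0≤y-x (a≤εn+b ε>0))
      (modulo (- (a - b)) (x*x⁻¹≡1 n+1>0)
        (solve 4 (λ a b n ω → con (ℤ.+ 0) :- (a :- b) :* ω
          := (a :- b) :* ω :* n :+ b :- a :+ ((n :+ con (ℤ.+ 1)) :* ω :- con (ℤ.+ 1)) :* (:- (a :- b)))
          refl a b n (x⁻¹ n+1>0))))
    (positive⇒≰0 ε>0)
    where
    n+1>0 : Positive (n + 1#)
    n+1>0 = positive-mono positive-1 (≤-by 0≤n (solve 1 (λ n → n :+ con (ℤ.+ 1) :- con (ℤ.+ 1) := n) refl n))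
    ε>0 = positive-* δ>0 (positive-inverse n+1>0)

  -- Completeness decides P: the supremum of {0} ∪ {1 | P} is 0 exactly when P fails.
  stable⇒dec : (P : Set) → (¬ ¬ P → P) → Dec P
  stable⇒dec P stable with supremum (λ y → y ≡ 0# ⊎ (y ≡ 1# × P)) (0# , inj₁ refl)
                             (1# , λ { (inj₁ refl) → 0≤1 ; (inj₂ (refl , _)) → ≤-refl })
  ... | s , upper , least with s ≟ 0#
  ...   | yes s≡0 = no λ p → 1≰0 (subst (1# ≤_) s≡0 (upper (inj₂ (refl , p))))
  ...   | no  s≢0 = yes (stable λ ¬p → s≢0 (antisym
    (least λ { (inj₁ refl) → ≤-refl ; (inj₂ (_ , p)) → contradiction p ¬p }) (upper (inj₁ refl))))

  -- Repetitions are allowed, so 2d rows can be drawn from any nonempty matrix, and an incoming row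
  -- may already be among the chosen ones.
  tuples : ∀ n k → List (Vec (Fin n) k)
  tuples n zero    = [] ∷ []
  tuples n (suc k) = cartesianProductWith _∷_ (allFin n) (tuples n k)

  ∈-tuples : (S : Vec (Fin n) k) → S ∈ tuples n k
  ∈-tuples []      = here refl
  ∈-tuples (i ∷ S) = ∈-cartesianProductWith⁺ _∷_ (∈-allFin i) (∈-tuples S)

  removeAt-map : ∀ {Y : Set} (f : X → Y) (xs : Vec X (suc k)) i → removeAt (map f xs) i ≡ map f (removeAt xs i)
  removeAt-map f (x ∷ xs)         zero    = refl
  removeAt-map f (x ∷ xs@(_ ∷ _)) (suc i) = cong (f x ∷_) (removeAt-map f xs i)

  DominatesUpTo : ℝ → Matrix n d → Vec (Fin n) k → Set
  DominatesUpTo ε A S = ∀ j x → (dot (lookup A j) x) ² ≤ ε * ‖ x ‖² + ∑ (λ v → (dot v x) ²) (map (lookup A) S)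

  Dominates : Matrix n d → Vec (Fin n) k → Set
  Dominates A S = ∀ j x → (dot (lookup A j) x) ² ≤ ∑ (λ v → (dot v x) ²) (map (lookup A) S)

  dominatesUpTo-mono : ∀ {ε ε′} (A : Matrix n d) (S : Vec (Fin n) k) →
                       ε ≤ ε′ → DominatesUpTo ε A S → DominatesUpTo ε′ A S
  dominatesUpTo-mono {ε = ε} {ε′} A S ε≤ε′ dom j x = ≤-trans (dom j x) (≤-by
    (*-nonNegative (‖‖²-nonNegative x) (x≤y⇒0≤y-x ε≤ε′))
    (solve 4 (λ ε ε′ n s → ε′ :* n :+ s :- (ε :* n :+ s) := n :* (ε′ :- ε)) refl ε ε′ ‖ x ‖²
      (∑ (λ v → (dot v x) ²) (map (lookup A) S))))

  maximal⇒dominatesUpTo : ∀ {ε} (ε>0 : Positive ε) (A : Matrix n d) (S : Vec (Fin n) (d ℕ.+ d)) →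
    (∀ T → det (gram ε>0 (map (lookup A) T)) ≤ det (gram ε>0 (map (lookup A) S))) → DominatesUpTo ε A S
  maximal⇒dominatesUpTo ε>0 A S maximal j x = subst ((dot (lookup A j) x) ² ≤_) (form-gram ε>0 (map (lookup A) S) x)
    (dual≤1⇒dot²≤form (gram ε>0 (map (lookup A) S)) (lookup A j)
      (exchange ε>0 (lookup A j) (map (lookup A) S) λ i →
        subst (λ vs → det (gram ε>0 vs) ≤ det (gram ε>0 (map (lookup A) S)))
          (sym (removeAt-map (lookup A) (j ∷ S) i)) (maximal (removeAt (j ∷ S) i))) x)

  dominatesUpTo-exists : ∀ {ε} → Positive ε → (A : Matrix (suc n) d) →
                         ∃ λ (S : Vec (Fin (suc n)) (d ℕ.+ d)) → DominatesUpTo ε A S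
  dominatesUpTo-exists {n} {d} ε>0 A = S , maximal⇒dominatesUpTo ε>0 A S
    λ T → All.lookup (f[xs]≤f[argmax] S₀ (tuples (suc n) (d ℕ.+ d))) (∈-tuples T)
    where
    S₀ = replicate (d ℕ.+ d) zero
    S = argmax (λ T → det (gram ε>0 (map (lookup A) T))) S₀ (tuples (suc n) (d ℕ.+ d))

  ¬dominates⇒¬dominatesUpTo : ∀ (A : Matrix n d) (S : Vec (Fin n) k) → ¬ Dominates A S →
                              ¬ ¬ (∃ λ ε → Positive ε × ¬ DominatesUpTo ε A S)
  ¬dominates⇒¬dominatesUpTo A S ¬dom none = ¬dom λ j x → ≤-vanishing (‖‖²-nonNegative x) λ {ε} ε>0 →
    decidable-stable (_ ≤? _) λ ≰ → none (ε , ε>0 , λ dom → ≰ (dom j x))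

  -- A tuple that fails at some ε fails at every smaller one, so the least of finitely many ε
  -- defeats all tuples at once. The ε are found only up to double negation, which suffices for a
  -- contradiction.
  uniform-failure : ∀ (A : Matrix n d) (Ss : List (Vec (Fin n) k)) → All (λ S → ¬ Dominates A S) Ss →
                    ¬ ¬ (∃ λ ε → Positive ε × All (λ S → ¬ DominatesUpTo ε A S) Ss)
  uniform-failure A []       []         none = none (1# , positive-1 , [])
  uniform-failure A (S ∷ Ss) (¬S ∷ ¬Ss) none =
    uniform-failure A Ss ¬Ss λ { (ε , ε>0 , ¬ε) →
    ¬dominates⇒¬dominatesUpTo A S ¬S λ { (δ , δ>0 , ¬δ) → case-total ε ε>0 ¬ε δ δ>0 ¬δ (total ε δ) }}
    where
    case-total : ∀ ε → Positive ε → All (λ S → ¬ DominatesUpTo ε A S) Ss → ∀ δ → Positive δ →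
                 ¬ DominatesUpTo δ A S → ε ≤ δ ⊎ δ ≤ ε → ⊥
    case-total ε ε>0 ¬ε δ δ>0 ¬δ (inj₁ ε≤δ) = none (ε , ε>0 , (¬δ ∘ dominatesUpTo-mono A S ε≤δ) ∷ ¬ε)
    case-total ε ε>0 ¬ε δ δ>0 ¬δ (inj₂ δ≤ε) =
      none (δ , δ>0 , ¬δ ∷ All.map (λ {T} ¬T → ¬T ∘ dominatesUpTo-mono A T δ≤ε) ¬ε)

  dominates-exists : (A : Matrix n d) → ∃ λ k → k ℕ.≤ d ℕ.+ d × ∃ λ (S : Vec (Fin n) k) → Dominates A S
  -- Without rows there is no index to fill 2d places with; hence the bound k ≤ 2d in place of
  -- equality.
  dominates-exists {zero}      A = 0 , ℕ.z≤n , [] , λ ()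
  dominates-exists {suc n} {d} A = d ℕ.+ d , ℕ.≤-refl , search (Any.any? (λ S → dominates? S) all)
    where
    all = tuples (suc n) (d ℕ.+ d)
    -- The property quantifies over all real vectors, but it is stable because `≤` is decidable.
    dominates? : ∀ S → Dec (Dominates A S)
    dominates? S = stable⇒dec (Dominates A S) λ ¬¬dom j x →
      decidable-stable (_ ≤? _) λ ≰ → ¬¬dom λ dom → ≰ (dom j x)
    search : Dec (Any (Dominates A) all) → ∃ λ (S : Vec (Fin (suc n)) (d ℕ.+ d)) → Dominates A S
    search (yes some) = Any.satisfied some
    search (no  none) = contradiction
      (λ { (ε , ε>0 , ¬dom) → let S , dom = dominatesUpTo-exists ε>0 A in All.lookup ¬dom (∈-tuples S) dom })
      (uniform-failure A all (All.¬Any⇒All¬ all none))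

  -- Existence of minimisers

  infix 4 _⊨_
  _⊨_ : List (Vector m) → Vector m → Set
  cs ⊨ y = All (λ c → 0# ≤ dot c y) cs

  -- Junk value: recip 0# ≡ 0#.
  recip : ℝ → ℝ
  recip x with x ≟ 0#
  ... | yes _   = 0#
  ... | no  x≢0 = proj₁ (inverse x x≢0)

  recip-unique : ∀ {x y} → x * y ≡ 1# → recip x ≡ y
  recip-unique {x} {y} xy≡1 with x ≟ 0#
  ... | yes refl = contradiction (trans (sym (zeroˡ y)) xy≡1) 0#≢1#
  ... | no  x≢0 with inverse x x≢0
  ...   | z , xz≡1 = modulo y xz≡1 (modulo (- z) xy≡1
    (solve 3 (λ x y z → z := (y :+ (x :* z :- con (ℤ.+ 1)) :* y) :+ (x :* y :- con (ℤ.+ 1)) :* (:- z)) refl x y z))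

  interpolate : (ls us : List ℝ) → All (λ l → All (l ≤_) us) ls → ∃ λ ξ → All (_≤ ξ) ls × All (ξ ≤_) us
  interpolate []       []       _ = 0# , [] , []
  interpolate []       (u ∷ us) _ with interpolate [] us []
  ... | ξ , _ , ξ≤us with total ξ u
  ...   | inj₁ ξ≤u = ξ , [] , ξ≤u ∷ ξ≤us
  ...   | inj₂ u≤ξ = u , [] , ≤-refl ∷ All.map (≤-trans u≤ξ) ξ≤us
  interpolate (l ∷ ls) us (l≤us ∷ ls≤us) with interpolate ls us ls≤us
  ... | ξ , ls≤ξ , ξ≤us with total ξ l
  ...   | inj₁ ξ≤l = l , ≤-refl ∷ All.map (λ p → ≤-trans p ξ≤l) ls≤ξ , l≤us
  ...   | inj₂ l≤ξ = ξ , l≤ξ ∷ ls≤ξ , ξ≤us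

  module _ {m : ℕ} where
    Rising Falling Flat : Vector (suc m) → Set
    Rising  c = ¬ head c ≤ 0#
    Falling c = ¬ 0# ≤ head c
    Flat    c = head c ≡ 0#

    rising? : ∀ c → Dec (Rising c)
    rising? c = ¬? (head c ≤? 0#)

    falling? : ∀ c → Dec (Falling c)
    falling? c = ¬? (0# ≤? head c)

    flat? : ∀ c → Dec (Flat c)
    flat? c = head c ≟ 0#

    -- For p rising and n falling both weights are positive, and they are chosen so that the
    -- eliminated coordinate cancels.
    combine : Vector (suc m) → Vector (suc m) → Vector m
    combine p n = 0ᵥ +[ head p ] tail n +[ - head n ] tail p

    eliminate : List (Vector (suc m)) → List (Vector m)
    eliminate cs = List.map tail (filter flat? cs)
      List.++ cartesianProductWith combine (filter rising? cs) (filter falling? cs)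

    dot-combine : ∀ p n y → dot (combine p n) y ≡ head p * dot (tail n) y + - head n * dot (tail p) y
    dot-combine p n y = trans (dot-+[] (0ᵥ +[ head p ] tail n) (- head n) (tail p) y)
      (cong (_+ - head n * dot (tail p) y) (trans (dot-+[] 0ᵥ (head p) (tail n) y)
        (trans (cong (_+ head p * dot (tail n) y) (dot-0ᵥˡ y)) (+-identityˡ (head p * dot (tail n) y)))))

    falling⇒positive : ∀ c → Falling c → Positive (- head c)
    falling⇒positive c ↓c = ≰0⇒positive λ -h≤0 → ↓c (≤-by (neg-nonNegative -h≤0)
      (solve 1 (λ h → h :- con (ℤ.+ 0) := :- (:- h)) refl (head c)))

    eliminate-sound : ∀ cs {ξ y} → cs ⊨ (ξ ∷ y) → eliminate cs ⊨ y
    eliminate-sound cs {ξ} {y} sat = All.++⁺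
      (All.map⁺ (All.tabulate λ {c} c∈ → let c∈cs , flat = ∈-filter⁻ flat? {xs = cs} c∈ in
        ignore c flat (All.lookup sat c∈cs)))
      (All.cartesianProductWith⁺ (setoid _) (setoid _) combine _ _ λ {p} {n} p∈ n∈ →
        let p∈cs , ↑p = ∈-filter⁻ rising? {xs = cs} p∈ ; n∈cs , ↓n = ∈-filter⁻ falling? {xs = cs} n∈ in
        add p n ↑p ↓n (All.lookup sat p∈cs) (All.lookup sat n∈cs))
      where
      ignore : ∀ c → Flat c → 0# ≤ dot c (ξ ∷ y) → 0# ≤ dot (tail c) y
      ignore (_ ∷ c) refl = subst (0# ≤_) (trans (cong (_+ dot c y) (zeroˡ ξ)) (+-identityˡ (dot c y)))
      add : ∀ p n → Rising p → Falling n → 0# ≤ dot p (ξ ∷ y) → 0# ≤ dot n (ξ ∷ y) → 0# ≤ dot (combine p n) y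
      add p@(α ∷ p′) n@(β ∷ n′) ↑p ↓n 0≤p 0≤n = subst (0# ≤_)
        (trans (solve 5 (λ α β ξ s t → α :* (β :* ξ :+ t) :+ (:- β) :* (α :* ξ :+ s) := α :* t :+ (:- β) :* s)
                 refl α β ξ (dot p′ y) (dot n′ y))
               (sym (dot-combine p n y)))
        (+-nonNegative (*-nonNegative (nonNegative (≰0⇒positive ↑p)) 0≤n)
                       (*-nonNegative (nonNegative (falling⇒positive n ↓n)) 0≤p))

    -- The ξ at which c vanishes over y: a lower bound on ξ if c is rising, an upper bound if it is
    -- falling. The total `recip` allows mapping it over lists without carrying proofs.
    root : Vector m → Vector (suc m) → ℝ
    root y c = - dot (tail c) y * recip (head c)

    module _ {y : Vector m} where
      recip-falling : ∀ c (↓c : Falling c) → recip (head c) ≡ - x⁻¹ (falling⇒positive c ↓c)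
      recip-falling c ↓c = recip-unique (trans
        (solve 2 (λ h i → h :* (:- i) := (:- h) :* i) refl (head c) _) (x*x⁻¹≡1 (falling⇒positive c ↓c)))

      -- The combined constraint is divided by the positive number `head p * - head n`.
      roots-ordered : ∀ p n → Rising p → Falling n → 0# ≤ dot (combine p n) y → root y p ≤ root y n
      roots-ordered p n ↑p ↓n 0≤pn = ≤-by
        (*-nonNegative (*-nonNegative (inverseNonNegative p>0) (inverseNonNegative n<0))
                       (subst (0# ≤_) (dot-combine p n y) 0≤pn))
        (modulo (- (dot (tail p) y * α′)) (x*x⁻¹≡1 n<0) (modulo (- (dot (tail n) y * β′)) (x*x⁻¹≡1 p>0)
          (trans (cong₂ (λ a b → - dot (tail n) y * b - - dot (tail p) y * a)
                        (recip-unique (x*x⁻¹≡1 p>0)) (recip-falling n ↓n))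
            (solve 6 (λ α α′ β β′ s t → (:- t) :* (:- β′) :- (:- s) :* α′
              := α′ :* β′ :* (α :* t :+ (:- β) :* s)
                 :+ ((:- β) :* β′ :- con (ℤ.+ 1)) :* (:- (s :* α′))
                 :+ (α :* α′ :- con (ℤ.+ 1)) :* (:- (t :* β′)))
              refl (head p) α′ (head n) β′ (dot (tail p) y) (dot (tail n) y)))))
        where
        p>0 = ≰0⇒positive ↑p
        n<0 = falling⇒positive n ↓n
        α′ = x⁻¹ p>0
        β′ = x⁻¹ n<0

      above-root : ∀ c {ξ} → Rising c → root y c ≤ ξ → 0# ≤ dot c (ξ ∷ y)
      above-root c@(α ∷ c′) {ξ} ↑c r≤ξ = ≤-by
        (*-nonNegative (nonNegative c>0) (x≤y⇒0≤y-x r≤ξ))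
        (modulo (- dot c′ y) (x*x⁻¹≡1 c>0) (trans
          (solve 4 (λ α α′ ξ s → α :* ξ :+ s :- con (ℤ.+ 0)
            := α :* (ξ :- (:- s) :* α′) :+ (α :* α′ :- con (ℤ.+ 1)) :* (:- s)) refl α (x⁻¹ c>0) ξ (dot c′ y))
          (cong (λ r → α * (ξ - - dot c′ y * r) + (α * x⁻¹ c>0 - 1#) * (- dot c′ y))
            (sym (recip-unique (x*x⁻¹≡1 c>0))))))
        where c>0 = ≰0⇒positive ↑c

      below-root : ∀ c {ξ} → Falling c → ξ ≤ root y c → 0# ≤ dot c (ξ ∷ y)
      below-root c@(α ∷ c′) {ξ} ↓c ξ≤r = ≤-by
        (*-nonNegative (nonNegative c<0) (x≤y⇒0≤y-x ξ≤r))
        (modulo (- dot c′ y) (x*x⁻¹≡1 c<0) (trans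
          (solve 4 (λ α α′ ξ s → α :* ξ :+ s :- con (ℤ.+ 0)
            := (:- α) :* ((:- s) :* (:- α′) :- ξ) :+ ((:- α) :* α′ :- con (ℤ.+ 1)) :* (:- s)) refl α (x⁻¹ c<0) ξ (dot c′ y))
          (cong (λ r → - α * (- dot c′ y * r - ξ) + (- α * x⁻¹ c<0 - 1#) * (- dot c′ y))
            (sym (recip-falling c ↓c)))))
        where c<0 = falling⇒positive c ↓c

    flat-case : ∀ c {ξ y} → Flat c → 0# ≤ dot (tail c) y → 0# ≤ dot c (ξ ∷ y)
    flat-case (_ ∷ c) {ξ} {y} refl = subst (0# ≤_)
      (sym (trans (cong (_+ dot c y) (zeroˡ ξ)) (+-identityˡ (dot c y))))

    -- The combined constraints put every lower bound on ξ below every upper bound, so some ξ lies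
    -- between them; flat constraints do not involve ξ.
    eliminate-complete : ∀ cs {y} → eliminate cs ⊨ y → ∃ λ ξ → cs ⊨ (ξ ∷ y)
    eliminate-complete cs {y} sat = ξ , All.tabulate (λ {c} c∈cs → satisfied c c∈cs (rising? c) (falling? c))
      where
      flat    = filter flat? cs
      rising  = filter rising? cs
      falling = filter falling? cs

      flat-sat : List.map tail flat ⊨ y
      flat-sat = All.++⁻ˡ (List.map tail flat) sat

      combined-sat : cartesianProductWith combine rising falling ⊨ y
      combined-sat = All.++⁻ʳ (List.map tail flat) sat

      ordered : All (λ l → All (l ≤_) (List.map (root y) falling)) (List.map (root y) rising)
      ordered = All.map⁺ (All.tabulate λ {p} p∈ → All.map⁺ (All.tabulate λ {n} n∈ →
        roots-ordered p n (proj₂ (∈-filter⁻ rising? {xs = cs} p∈)) (proj₂ (∈-filter⁻ falling? {xs = cs} n∈))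
          (All.lookup combined-sat (∈-cartesianProductWith⁺ combine p∈ n∈))))

      between : ∃ λ ξ → All (_≤ ξ) (List.map (root y) rising) × All (ξ ≤_) (List.map (root y) falling)
      between = interpolate (List.map (root y) rising) (List.map (root y) falling) ordered

      ξ : ℝ
      ξ = proj₁ between

      satisfied : ∀ c → c ∈ cs → Dec (Rising c) → Dec (Falling c) → 0# ≤ dot c (ξ ∷ y)
      satisfied c c∈cs (yes ↑c) _        = above-root c ↑c
        (All.lookup (proj₁ (proj₂ between)) (∈-map⁺ (root y) (∈-filter⁺ rising? c∈cs ↑c)))
      satisfied c c∈cs (no _)   (yes ↓c) = below-root c ↓c
        (All.lookup (proj₂ (proj₂ between)) (∈-map⁺ (root y) (∈-filter⁺ falling? c∈cs ↓c)))
      satisfied c c∈cs (no ¬↑c) (no ¬↓c) = flat-case c level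
        (All.lookup flat-sat (∈-map⁺ tail (∈-filter⁺ flat? c∈cs level)))
        where
        level : Flat c
        level = antisym (decidable-stable (head c ≤? 0#) ¬↑c) (decidable-stable (0# ≤? head c) ¬↓c)

  -- The kept coordinates will be t and the constant 1.
  project : ∀ d (cs : List (Vector (d ℕ.+ m))) → ∃ λ (cs′ : List (Vector m)) → ∀ z →
            ((∃ λ (x : Vector d) → cs ⊨ x ++ z) → cs′ ⊨ z) × (cs′ ⊨ z → ∃ λ (x : Vector d) → cs ⊨ x ++ z)
  project zero    cs = cs , λ z → (λ { ([] , sat) → sat }) , λ sat → [] , sat
  project (suc d) cs with project d (eliminate cs)
  ... | cs′ , correct = cs′ , λ z →
    (λ { (ξ ∷ x , sat) → proj₁ (correct z) (x , eliminate-sound cs sat) }) ,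
    λ sat → let x , satₓ = proj₂ (correct z) sat ; ξ , satξ = eliminate-complete cs satₓ in ξ ∷ x , satξ

  -- The residual norm as a system of linear constraints

  dot-++ : ∀ (a x : Vector d) (c z : Vector m) → dot (a ++ c) (x ++ z) ≡ dot a x + dot c z
  dot-++ []      []      c z = sym (+-identityˡ _)
  dot-++ (α ∷ a) (ξ ∷ x) c z = trans (cong (α * ξ +_) (dot-++ a x c z)) (sym (+-assoc _ _ _))

  -- The trailing 1 lets homogeneous constraints express affine conditions on t.
  at : ℝ → Vector 2
  at t = t ∷ 1# ∷ []

  -- At x ++ at t these constraints say 0 ≤ t and ∣⟨a , x⟩ - β∣ ≤ t for each row a and entry β.
  residualBound : Matrix n d → Vector n → List (Vector (d ℕ.+ 2))
  residualBound []      []      = (0ᵥ ++ (1# ∷ 0# ∷ [])) ∷ []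
  residualBound (a ∷ A) (β ∷ b) = ((0ᵥ +[ - 1# ] a) ++ (1# ∷ β ∷ [])) ∷ (a ++ (1# ∷ - β ∷ [])) ∷ residualBound A b

  residualBound-upper : ∀ (a x : Vector d) β t →
    dot ((0ᵥ +[ - 1# ] a) ++ (1# ∷ β ∷ [])) (x ++ at t) ≡ t - (dot a x - β)
  residualBound-upper a x β t = trans (dot-++ (0ᵥ +[ - 1# ] a) x (1# ∷ β ∷ []) (at t))
    (trans (cong (_+ dot (1# ∷ β ∷ []) (at t)) (trans (dot-+[] 0ᵥ (- 1#) a x) (cong (_+ - 1# * dot a x) (dot-0ᵥˡ x))))
      (solve 3 (λ s β t → let o = con (ℤ.+ 1) ; z = con (ℤ.+ 0) in
        z :+ (:- o) :* s :+ (o :* t :+ (β :* o :+ z)) := t :- (s :- β)) refl (dot a x) β t))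

  residualBound-lower : ∀ (a x : Vector d) β t → dot (a ++ (1# ∷ - β ∷ [])) (x ++ at t) ≡ t - - (dot a x - β)
  residualBound-lower a x β t = trans (dot-++ a x (1# ∷ - β ∷ []) (at t))
      (solve 3 (λ s β t → let o = con (ℤ.+ 1) ; z = con (ℤ.+ 0) in
        s :+ (o :* t :+ ((:- β) :* o :+ z)) := t :- (:- (s :- β))) refl (dot a x) β t)

  norm≤⇒residualBound : ∀ (A : Matrix n d) b x t → ‖ A · x ⊖ b ‖∞ ≤ t → residualBound A b ⊨ x ++ at t
  norm≤⇒residualBound []      []      x t 0≤t = subst (0# ≤_) (sym (trans (dot-++ 0ᵥ x (1# ∷ 0# ∷ []) (at t))
    (trans (cong (_+ dot (1# ∷ 0# ∷ []) (at t)) (dot-0ᵥˡ x))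
      (solve 1 (λ t → let o = con (ℤ.+ 1) ; z = con (ℤ.+ 0) in z :+ (o :* t :+ (z :* o :+ z)) := t) refl t)))) 0≤t ∷ []
  norm≤⇒residualBound (a ∷ A) (β ∷ b) x t ≤t =
    subst (0# ≤_) (sym (residualBound-upper a x β t)) (x≤y⇒0≤y-x (≤-trans (x≤x⊔y r (- r)) ∣r∣≤t))
    ∷ subst (0# ≤_) (sym (residualBound-lower a x β t)) (x≤y⇒0≤y-x (≤-trans (x≤y⊔x r (- r)) ∣r∣≤t))
    ∷ norm≤⇒residualBound A b x t (≤-trans (x≤y⊔x ∣ r ∣ ‖ A · x ⊖ b ‖∞) ≤t)
    where
    r = dot a x - β
    ∣r∣≤t : ∣ r ∣ ≤ t
    ∣r∣≤t = ≤-trans (x≤x⊔y ∣ r ∣ ‖ A · x ⊖ b ‖∞) ≤t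

  residualBound⇒norm≤ : ∀ (A : Matrix n d) b x t → residualBound A b ⊨ x ++ at t → ‖ A · x ⊖ b ‖∞ ≤ t
  residualBound⇒norm≤ []      []      x t (0≤t ∷ []) = subst (0# ≤_) (trans (dot-++ 0ᵥ x (1# ∷ 0# ∷ []) (at t))
    (trans (cong (_+ dot (1# ∷ 0# ∷ []) (at t)) (dot-0ᵥˡ x))
      (solve 1 (λ t → let o = con (ℤ.+ 1) ; z = con (ℤ.+ 0) in z :+ (o :* t :+ (z :* o :+ z)) := t) refl t))) 0≤t
  residualBound⇒norm≤ (a ∷ A) (β ∷ b) x t (upper ∷ lower ∷ rest) = ⊔-lub
    (⊔-lub (0≤y-x⇒x≤y (subst (0# ≤_) (residualBound-upper a x β t) upper))
           (0≤y-x⇒x≤y (subst (0# ≤_) (residualBound-lower a x β t) lower)))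
    (residualBound⇒norm≤ A b x t rest)

  ‖‖∞-nonNegative : (v : Vector n) → 0# ≤ ‖ v ‖∞
  ‖‖∞-nonNegative []      = ≤-refl
  ‖‖∞-nonNegative (ξ ∷ v) = ≤-trans (‖‖∞-nonNegative v) (x≤y⊔x ∣ ξ ∣ ‖ v ‖∞)

  minimizer : (A : Matrix n d) (b : Vector n) → ∃ λ x* → ∀ x → ‖ A · x* ⊖ b ‖∞ ≤ ‖ A · x ⊖ b ‖∞
  minimizer {n} {d} A b = x* , λ x →
    ≤-trans (residualBound⇒norm≤ A b x* t* x*-feasible) (least λ lower → lower (norm-feasible x))
    where
    norm : Vector d → ℝ
    norm x = ‖ A · x ⊖ b ‖∞
    projection = project d (residualBound A b)
    cs = proj₁ projection

    norm-feasible : ∀ x → cs ⊨ at (norm x)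
    norm-feasible x = proj₁ (proj₂ projection (at (norm x))) (x , norm≤⇒residualBound A b x (norm x) ≤-refl)

    LowerBound : ℝ → Set
    LowerBound l = ∀ {t} → cs ⊨ at t → l ≤ t

    t₀ = norm 0ᵥ
    -- The infimum of the feasible t, obtained as the supremum of their lower bounds: 0 is one of
    -- these, and the feasible `t₀` bounds them all.
    infimum = supremum LowerBound
      (0# , λ {t} sat → let x , satₓ = proj₂ (proj₂ projection (at t)) sat in
        ≤-trans (‖‖∞-nonNegative (A · x ⊖ b)) (residualBound⇒norm≤ A b x t satₓ))
      (t₀ , λ lower → lower (norm-feasible 0ᵥ))
    t* = proj₁ infimum
    greatest : ∀ {l} → LowerBound l → l ≤ t*
    greatest = proj₁ (proj₂ infimum)
    least : ∀ {u} → (∀ {l} → LowerBound l → l ≤ u) → t* ≤ u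
    least = proj₂ (proj₂ infimum)

    -- The constraint reads p t + q ≥ 0. If p ≤ 0, it passes from the feasible `t₀` down to `t*`. If
    -- p > 0, then - q / p is a lower bound of the feasible t, hence at most `t*`.
    constraint : ∀ c → c ∈ cs → 0# ≤ dot c (at t*)
    constraint c@(p ∷ q ∷ []) c∈cs with sign p
    ... | inj₁ p≤0 = ≤-by
      (+-nonNegative
        (*-nonNegative (neg-nonNegative p≤0) (x≤y⇒0≤y-x (least λ lower → lower (norm-feasible 0ᵥ))))
        (All.lookup (norm-feasible 0ᵥ) c∈cs))
      (solve 4 (λ p q t s → let o = con (ℤ.+ 1) ; z = con (ℤ.+ 0) in
        p :* t :+ (q :* o :+ z) :- z := (:- p) :* (s :- t) :+ (p :* s :+ (q :* o :+ z))) refl p q t* t₀)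
    ... | inj₂ p>0 = ≤-by
      (*-nonNegative (nonNegative p>0) (x≤y⇒0≤y-x (greatest λ {t} sat → ≤-by
        (*-nonNegative (inverseNonNegative p>0) (All.lookup sat c∈cs))
        (modulo (- t) (x*x⁻¹≡1 p>0)
          (solve 4 (λ p p′ q t → let o = con (ℤ.+ 1) ; z = con (ℤ.+ 0) in
            t :- (:- q) :* p′ := p′ :* (p :* t :+ (q :* o :+ z)) :+ (p :* p′ :- o) :* (:- t)) refl p (x⁻¹ p>0) q t)))))
      (modulo (- q) (x*x⁻¹≡1 p>0)
        (solve 4 (λ p p′ q t → let o = con (ℤ.+ 1) ; z = con (ℤ.+ 0) in
          p :* t :+ (q :* o :+ z) :- z := p :* (t :- (:- q) :* p′) :+ (p :* p′ :- o) :* (:- q)) refl p (x⁻¹ p>0) q t*))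

    optimum = proj₂ (proj₂ projection (at t*)) (All.tabulate λ {c} → constraint c)
    x* = proj₁ optimum
    x*-feasible = proj₂ optimum

  -- The algorithm

  ∣lookup∣≤‖‖∞ : ∀ (v : Vector n) i → ∣ lookup v i ∣ ≤ ‖ v ‖∞
  ∣lookup∣≤‖‖∞ (ξ ∷ v) zero    = x≤x⊔y ∣ ξ ∣ ‖ v ‖∞
  ∣lookup∣≤‖‖∞ (ξ ∷ v) (suc i) = ≤-trans (∣lookup∣≤‖‖∞ v i) (x≤y⊔x ∣ ξ ∣ ‖ v ‖∞)

  ‖‖∞-lub : ∀ (v : Vector n) {t} → 0# ≤ t → (∀ i → ∣ lookup v i ∣ ≤ t) → ‖ v ‖∞ ≤ t
  ‖‖∞-lub []      0≤t v≤t = 0≤t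
  ‖‖∞-lub (ξ ∷ v) 0≤t v≤t = ⊔-lub (v≤t zero) (‖‖∞-lub v 0≤t (v≤t ∘ suc))

  lookup-residual : ∀ (A : Matrix n d) x b i → lookup (A · x ⊖ b) i ≡ dot (lookup A i) x - lookup b i
  lookup-residual A x b i = trans (lookup-zipWith _-_ i (A · x) b)
    (cong (_- lookup b i) (lookup-map i (λ row → dot row x) A))

  residual-sample : ∀ (A : Matrix n d) x b (S : Vec (Fin n) k) →
    map (lookup A) S · x ⊖ map (lookup b) S ≡ map (lookup (A · x ⊖ b)) S
  residual-sample A x b []      = refl
  residual-sample A x b (i ∷ S) = cong₂ _∷_ (sym (lookup-residual A x b i)) (residual-sample A x b S)

  dot-comm : ∀ (u v : Vector d) → dot u v ≡ dot v u
  dot-comm []      []      = refl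
  dot-comm (a ∷ u) (b ∷ v) = trans (cong (a * b +_) (dot-comm u v))
    (solve 3 (λ a b s → a :* b :+ s := b :* a :+ s) refl a b (dot v u))

  dot-difference : ∀ (a x y : Vector d) → dot a (x +[ - 1# ] y) ≡ dot a x - dot a y
  dot-difference a x y = trans (dot-comm a (x +[ - 1# ] y)) (trans (dot-+[] x (- 1#) y a)
    (trans (cong₂ (λ s t → s + - 1# * t) (dot-comm x a) (dot-comm y a))
      (solve 2 (λ s t → s :+ (:- con (ℤ.+ 1)) :* t := s :- t) refl (dot a x) (dot a y))))

  fromℕ-mono : ∀ {m n} → m ℕ.≤ n → fromℕ m ≤ fromℕ n
  fromℕ-mono {n = n} ℕ.z≤n   = 0≤fromℕ n
  fromℕ-mono (ℕ.s≤s m≤n) = +-monoˡ-≤ 1# (fromℕ-mono m≤n)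

  √-upper : ∀ k {y} → y ² ≤ fromℕ k → y ≤ √ k
  √-upper k = proj₁ (proj₂ (supremum (SquareAtMost k) (squareAtMost-inhabited k) (squareAtMost-bounded k)))

  1≤√ : ∀ d .{{_ : NonZero d}} → 1# ≤ √ d
  1≤√ d = √-upper d (subst (_≤ fromℕ d) (solve 0 (con (ℤ.+ 0) :+ con (ℤ.+ 1) := con (ℤ.+ 1) :* con (ℤ.+ 1)) refl)
    (fromℕ-mono (ℕ.>-nonZero⁻¹ d)))

  -- Rounding 8 up to the square 9 avoids √8.
  ≤3m√d : ∀ d {m t} → 0# ≤ m → t ² ≤ embed (ℤ.+ 8) * fromℕ d * m ² → t ≤ embed (ℤ.+ 3) * m * √ d
  ≤3m√d d {m} {t} 0≤m t²≤8dm² with sign m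
  ... | inj₁ m≤0 rewrite antisym m≤0 0≤m = ≤-trans t≤0
    (reflexive (solve 1 (λ r → con (ℤ.+ 0) := con (ℤ.+ 3) :* con (ℤ.+ 0) :* r) refl (√ d)))
    where
    t≤0 : t ≤ 0#
    t≤0 with sign t
    ... | inj₁ t≤0 = t≤0
    ... | inj₂ t>0 = contradiction (≤-trans t²≤8dm² (reflexive
      (solve 1 (λ n → con (ℤ.+ 8) :* n :* (con (ℤ.+ 0) :* con (ℤ.+ 0)) := con (ℤ.+ 0)) refl (fromℕ d))))
      (positive⇒≰0 (positive-* t>0 t>0))
  ... | inj₂ m>0 = ≤-by
    (*-nonNegative (nonNegative c>0) (x≤y⇒0≤y-x (√-upper d scaled²≤d)))
    (modulo t (x*x⁻¹≡1 c>0)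
      (solve 4 (λ m ι t r → let c = con (ℤ.+ 3) :* m in
        c :* r :- t := c :* (r :- t :* ι) :+ (c :* ι :- con (ℤ.+ 1)) :* t) refl m (x⁻¹ c>0) t (√ d)))
    where
    3>0 : Positive (embed (ℤ.+ 3))
    3>0 = positive-mono positive-1 (≤-by (+-nonNegative 0≤1 0≤1)
      (solve 0 (con (ℤ.+ 3) :- con (ℤ.+ 1) := con (ℤ.+ 1) :+ con (ℤ.+ 1)) refl))
    c>0 = positive-* 3>0 m>0
    ι = x⁻¹ c>0
    -- The supremum `√ d` bounds every y with y² ≤ d; here y = t / (3 m), using t² ≤ 8 d m² ≤ 9 d
    -- m².
    scaled²≤d : (t * ι) ² ≤ fromℕ d
    scaled²≤d = ≤-by
      (*-nonNegative (²-nonNegative ι)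
        (+-nonNegative (x≤y⇒0≤y-x t²≤8dm²) (*-nonNegative (0≤fromℕ d) (²-nonNegative m))))
      (modulo (- ((embed (ℤ.+ 3) * m * ι + 1#) * fromℕ d)) (x*x⁻¹≡1 c>0)
        (solve 4 (λ m ι t n → let c = con (ℤ.+ 3) :* m in
          n :- t :* ι :* (t :* ι)
          := ι :* ι :* (con (ℤ.+ 8) :* n :* (m :* m) :- t :* t :+ n :* (m :* m))
             :+ (c :* ι :- con (ℤ.+ 1)) :* (:- ((c :* ι :+ con (ℤ.+ 1)) :* n)))
          refl m ι t (fromℕ d)))

  -- If the samples of the residuals of x̃ and x* are at most μ, the vector x̃ - x* has
  -- image at most 2μ on the sampled rows, hence at most √(8d) μ on all rows.
  sample-and-solve : ∀ d .{{_ : NonZero d}} (A : Matrix n d) (b : Vector n) (S : Vec (Fin n) k) →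
    k ℕ.≤ d ℕ.+ d → Dominates A S → ∀ x̃ x* →
    ‖ map (lookup A) S · x̃ ⊖ map (lookup b) S ‖∞ ≤ ‖ map (lookup A) S · x* ⊖ map (lookup b) S ‖∞ →
    ‖ A · x̃ ⊖ b ‖∞ ≤ embed (ℤ.+ 4) * √ d * ‖ A · x* ⊖ b ‖∞
  sample-and-solve {n = n} {k = k} d A b S k≤2d dominates x̃ x* better = ‖‖∞-lub (A · x̃ ⊖ b) bound-nonNegative λ j →
    ⊔-lub
      (≤-by
        (+-nonNegative (+-nonNegative spare (x≤y⇒0≤y-x (proj₁ (optimal j)))) (x≤y⇒0≤y-x (proj₁ (difference j))))
        (trans (cong (λ p → embed (ℤ.+ 4) * √ d * μ - p) (lookup-residual A x̃ b j))
          (trans (solve 5 (λ r μ u v β → con (ℤ.+ 4) :* r :* μ :- (u :- β)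
            := μ :* (r :- con (ℤ.+ 1)) :+ (μ :- (v :- β)) :+ (con (ℤ.+ 3) :* μ :* r :- (u :- v)))
            refl (√ d) μ (dot (lookup A j) x̃) (dot (lookup A j) x*) (lookup b j))
          (cong₂ (λ p q → μ * (√ d - 1#) + (μ - p) + (embed (ℤ.+ 3) * μ * √ d - q))
            (sym (lookup-residual A x* b j)) (sym (dot-difference (lookup A j) x̃ x*))))))
      (≤-by
        (+-nonNegative (+-nonNegative spare (x≤y⇒0≤y-x (proj₂ (optimal j)))) (x≤y⇒0≤y-x (proj₂ (difference j))))
        (trans (cong (λ p → embed (ℤ.+ 4) * √ d * μ - - p) (lookup-residual A x̃ b j))
          (trans (solve 5 (λ r μ u v β → con (ℤ.+ 4) :* r :* μ :- (:- (u :- β))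
            := μ :* (r :- con (ℤ.+ 1)) :+ (μ :- (:- (v :- β))) :+ (con (ℤ.+ 3) :* μ :* r :- (:- (u :- v))))
            refl (√ d) μ (dot (lookup A j) x̃) (dot (lookup A j) x*) (lookup b j))
          (cong₂ (λ p q → μ * (√ d - 1#) + (μ - - p) + (embed (ℤ.+ 3) * μ * √ d - - q))
            (sym (lookup-residual A x* b j)) (sym (dot-difference (lookup A j) x̃ x*))))))
    where
    μ = ‖ A · x* ⊖ b ‖∞
    0≤μ = ‖‖∞-nonNegative (A · x* ⊖ b)
    z = x̃ +[ - 1# ] x*

    -- The residual of x* contributes μ ≤ μ √ d, as d ≥ 1. Added to 3 μ √ d for the difference, this
    -- makes the constant 4.
    spare : 0# ≤ μ * (√ d - 1#)
    spare = *-nonNegative 0≤μ (x≤y⇒0≤y-x (1≤√ d))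

    bound-nonNegative : 0# ≤ embed (ℤ.+ 4) * √ d * μ
    bound-nonNegative = *-nonNegative (*-nonNegative
      (+-nonNegative (+-nonNegative (+-nonNegative 0≤1 0≤1) 0≤1) 0≤1) (≤-trans 0≤1 (1≤√ d))) 0≤μ

    optimal : ∀ j → lookup (A · x* ⊖ b) j ≤ μ × - lookup (A · x* ⊖ b) j ≤ μ
    optimal j = ≤-trans (x≤x⊔y r (- r)) (∣lookup∣≤‖‖∞ (A · x* ⊖ b) j)
              , ≤-trans (x≤y⊔x r (- r)) (∣lookup∣≤‖‖∞ (A · x* ⊖ b) j)
      where r = lookup (A · x* ⊖ b) j

    sampled≤μ : ‖ map (lookup A) S · x̃ ⊖ map (lookup b) S ‖∞ ≤ μ
    sampled≤μ = ≤-trans better (subst (λ v → ‖ v ‖∞ ≤ μ) (sym (residual-sample A x* b S))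
      (‖‖∞-lub (map (lookup (A · x* ⊖ b)) S) 0≤μ λ i →
        subst (λ r → ∣ r ∣ ≤ μ) (sym (lookup-map i (lookup (A · x* ⊖ b)) S)) (∣lookup∣≤‖‖∞ (A · x* ⊖ b) (lookup S i))))

    sampled : ∀ i → lookup (A · x̃ ⊖ b) (lookup S i) ≤ μ × - lookup (A · x̃ ⊖ b) (lookup S i) ≤ μ
    sampled i = ≤-trans (x≤x⊔y r (- r)) ∣r∣≤μ , ≤-trans (x≤y⊔x r (- r)) ∣r∣≤μ
      where
      r = lookup (A · x̃ ⊖ b) (lookup S i)
      ∣r∣≤μ : ∣ r ∣ ≤ μ
      ∣r∣≤μ = subst (λ r → ∣ r ∣ ≤ μ)
        (trans (cong (λ v → lookup v i) (residual-sample A x̃ b S)) (lookup-map i (lookup (A · x̃ ⊖ b)) S))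
        (≤-trans (∣lookup∣≤‖‖∞ (map (lookup A) S · x̃ ⊖ map (lookup b) S) i) sampled≤μ)

    -- For the residuals p of x̃ and q of x* in a sampled row, b cancels in p - q, and 4 μ² - (p -
    -- q)² is the product of (μ - p) + (μ + q) and (μ + p) + (μ - q).
    difference-sampled : ∀ i → (dot (lookup (map (lookup A) S) i) z) ² ≤ embed (ℤ.+ 4) * μ ²
    difference-sampled i = ≤-by
      (*-nonNegative
        (+-nonNegative (x≤y⇒0≤y-x (proj₁ (sampled i))) (x≤y⇒0≤y-x (proj₂ (optimal s))))
        (+-nonNegative (x≤y⇒0≤y-x (proj₂ (sampled i))) (x≤y⇒0≤y-x (proj₁ (optimal s)))))
      (trans (cong (λ p → embed (ℤ.+ 4) * μ ² - p ²)
          (trans (cong (λ a → dot a z) (lookup-map i (lookup A) S)) (dot-difference (lookup A s) x̃ x*)))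
        (trans (solve 4 (λ μ u v β → let p = u :- β ; q = v :- β in
            con (ℤ.+ 4) :* (μ :* μ) :- (u :- v) :* (u :- v)
            := (μ :- p :+ (μ :- (:- q))) :* (μ :- (:- p) :+ (μ :- q)))
            refl μ (dot (lookup A s) x̃) (dot (lookup A s) x*) (lookup b s))
          (cong₂ (λ p q → (μ - p + (μ - - q)) * (μ - - p + (μ - q)))
            (sym (lookup-residual A x̃ b s)) (sym (lookup-residual A x* b s)))))
      where s = lookup S i

    -- At most 2d sampled squares, each at most 4 μ², give the factor 8.
    difference² : ∀ j → (dot (lookup A j) z) ² ≤ embed (ℤ.+ 8) * fromℕ d * μ ²
    difference² j = ≤-trans (dominates j z)
      (≤-trans (∑-bound (λ v → (dot v z) ²) (embed (ℤ.+ 4) * μ ²) (map (lookup A) S) difference-sampled)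
        (≤-by
          (*-nonNegative (x≤y⇒0≤y-x (fromℕ-mono k≤2d))
            (*-nonNegative (+-nonNegative (+-nonNegative (+-nonNegative 0≤1 0≤1) 0≤1) 0≤1) (²-nonNegative μ)))
          (trans (solve 3 (λ n k μ → con (ℤ.+ 8) :* n :* (μ :* μ) :- k :* (con (ℤ.+ 4) :* (μ :* μ))
              := (n :+ n :- k) :* (con (ℤ.+ 4) :* (μ :* μ))) refl (fromℕ d) (fromℕ k) μ)
            (cong (λ n → (n - fromℕ k) * (embed (ℤ.+ 4) * μ ²)) (sym (fromℕ-+ d d))))))

    difference : ∀ j → dot (lookup A j) z ≤ embed (ℤ.+ 3) * μ * √ d × - dot (lookup A j) z ≤ embed (ℤ.+ 3) * μ * √ d
    difference j = ≤3m√d d 0≤μ (difference² j)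
      , ≤3m√d d 0≤μ (subst (_≤ embed (ℤ.+ 8) * fromℕ d * μ ²)
          (solve 1 (λ t → t :* t := (:- t) :* (:- t)) refl (dot (lookup A j) z)) (difference² j))

  readAll : ∀ {Out} → Vec (Fin n) k → (Vector k → Out) → QueryAlgorithm n Out
  readAll []      f = output (f [])
  readAll (i ∷ S) f = read i λ β → readAll S (f ∘ (β ∷_))

  run-readAll : ∀ {Out} (S : Vec (Fin n) k) (f : Vector k → Out) b → run (readAll S f) b ≡ f (map (lookup b) S)
  run-readAll []      f b = refl
  run-readAll (i ∷ S) f b = run-readAll S (f ∘ (lookup b i ∷_)) b

  queries-readAll : ∀ {Out} (S : Vec (Fin n) k) (f : Vector k → Out) b → queries (readAll S f) b ≡ k
  queries-readAll []      f b = refl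
  queries-readAll (i ∷ S) f b = cong suc (queries-readAll S (f ∘ (lookup b i ∷_)) b)

  -- S depends on `A` alone, so the positions to read are fixed before any value is seen.
  solver : Matrix n d → QueryAlgorithm n (Vector d)
  solver A with dominates-exists A
  ... | k , _ , S , _ = readAll S λ β → proj₁ (minimizer (map (lookup A) S) β)

  solver-queries : ∀ (A : Matrix n d) b → queries (solver A) b ℕ.≤ d ℕ.+ d
  solver-queries {d = d} A b with dominates-exists A
  ... | k , k≤2d , S , _ = subst (ℕ._≤ d ℕ.+ d)
    (sym (queries-readAll S (λ β → proj₁ (minimizer (map (lookup A) S) β)) b)) k≤2d

  solver-correct : ∀ d .{{_ : NonZero d}} (A : Matrix n d) b x →
    ‖ A · run (solver A) b ⊖ b ‖∞ ≤ embed (ℤ.+ 4) * √ d * ‖ A · x ⊖ b ‖∞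
  solver-correct d A b x with dominates-exists A
  ... | k , k≤2d , S , dominates = subst (λ x̃ → ‖ A · x̃ ⊖ b ‖∞ ≤ embed (ℤ.+ 4) * √ d * ‖ A · x ⊖ b ‖∞)
    (sym (run-readAll S (λ β → proj₁ (minimizer (map (lookup A) S) β)) b))
    (sample-and-solve d A b S k≤2d dominates _ x (proj₂ (minimizer (map (lookup A) S) (map (lookup b) S)) x))

theorem14p2 : (R : CompleteOrderedField) → let open Regression R in
    ∃ λ (K : ℕ) → ∃ λ (C : ℝ) →
    Σ (∀ {n d} → Matrix n d → QueryAlgorithm n (Vector d)) λ algorithm →
    ∀ (n d : ℕ) .{{_ : NonZero d}} (A : Matrix n d) (b : Vector n) →
    (queries (algorithm A) b ℕ.≤ K ℕ.* (d ℕ.* loglog d))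
    × (∃ λ (m : ℝ) → IsMinimum (λ (x : Vector d) → ‖ A · x ⊖ b ‖∞) m
    × ‖ A · run (algorithm A) b ⊖ b ‖∞ ≤ C * √ d * m)
theorem14p2 R = 2 , embed (ℤ.+ 4) , solver , λ n d A b →
  let x* , optimal = minimizer A b in
  ℕ.≤-trans (solver-queries A b) (2d≤ d) , _ , ((x* , refl) , optimal) , solver-correct d A b x*
  where
  open IntegerCoefficients R using (embed)
  open RegressionCoreset R
  -- `loglog d` is a maximum with 1, so multiplying by it does not decrease 2d.
  2d≤ : ∀ d → d ℕ.+ d ℕ.≤ 2 ℕ.* (d ℕ.* loglog d)
  2d≤ d = ℕ.≤-trans (ℕ.≤-reflexive (cong (d ℕ.+_) (sym (ℕ.+-identityʳ d))))
    (ℕ.*-monoʳ-≤ 2 (ℕ.≤-trans (ℕ.≤-reflexive (sym (ℕ.*-identityʳ d))) (ℕ.*-monoʳ-≤ d (ℕ.m≤m⊔n 1 ⌊log₂ ⌊log₂ d ⌋ ⌋))))
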